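{- Let $\mathcal{P}$ be the set of all non-empty primitive interval orders (up to isomorphism), and define the formal power series \[ \mathbf{P}(t,v,w,x,y)=\sum_{P\in\mathcal{P}} t^{\mathrm{mag}(P)}x^{\mathrm{iso}(P)} y^{\min(P)} v^{\max(P)} w^{\mathrm{int}(P)}. \] For integers $n\ge 0$ let $V_n(a,b)=(a+1)(b+1)^n-1$. Then \[ \mathbf{P}(t,v,w,x,y) =\sum_{n\ge 0}t^{n+1}\frac{V_n(x,y)}{1+tV_n(v,w)}\prod_{i=0}^{n-1}\frac{V_i(v,w)}{1+tV_i(v,w)}. \]
   Context: All posets are finite and considered up to isomorphism. An interval order is a poset with no induced subposet isomorphic to the disjoint union of two 2-element chains. For an element $x$ of a poset $P$, its strict down-set is $D(x)=\{y\in P: y<x\}$ and its strict up-set is $U(x)=\{y\in P: y>x\}$; in an interval order the strict down-sets are totally ordered by inclusion. The magnitude $\mathrm{mag}(P)$ of an interval order $P$ is the number of distinct strict down-sets $D(x)$, $x\in P$. Two elements $x,y$ are indistinguishable if $D(x)=D(y)$ and $U(x)=U(y)$; $P$ is primitive if no two distinct elements are indistinguishable. An element is isolated if it is comparable to no other element, and internal if it is neither minimal nor maximal. The statistics are: $\mathrm{iso}(P)$ = number of isolated elements; $\min(P)$ = number of non-isolated minimal elements; $\max(P)$ = number of non-isolated maximal elements; $\mathrm{int}(P)$ = number of internal elements. The identity is an identity of formal power series (the right-hand side converges in the formal topology). -}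

module Defs where

open import Data.Nat as ℕ using (ℕ; zero; suc; _∸_; _≡ᵇ_)
open import Data.Integer as ℤ using (ℤ; +_; 0ℤ; 1ℤ)
open import Data.Bool using (Bool; true; false; _∧_; _∨_; not; if_then_else_)
open import Data.Fin using (Fin)
open import Data.Fin.Properties using () renaming (_≟_ to _≟F_)
open import Data.List using (List; length; map; deduplicate; filterᵇ)
open import Data.Bool.ListAction using (any)
open import Data.List using () renaming (allFin to allFinL)
open import Data.Vec using (Vec; tabulate)
open import Data.Vec.Properties using (≡-dec)
open import Data.Bool.Properties using () renaming (_≟_ to _≟B_)
open import Data.Product using (Σ; ∃; _×_; _,_)
open import Relation.Binary.PropositionalEquality using (_≡_)
open import Relation.Nullary using (¬_)
open import Function.Bundles using (_↔_; Inverse)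
open import Data.List.Membership.Propositional using (_∈_)
open import Data.List.Relation.Unary.All using () renaming (All to AllL)
open import Data.List.Relation.Unary.Any using () renaming (Any to AnyL)
open import Data.List.Relation.Unary.AllPairs using (AllPairs)

record Poset (k : ℕ) : Set where
  field
    _≺_    : Fin k → Fin k → Bool
    irrefl : ∀ x → (x ≺ x) ≡ false
    trans  : ∀ x y z → (x ≺ y) ≡ true → (y ≺ z) ≡ true → (x ≺ z) ≡ true

FinPoset : Set
FinPoset = Σ ℕ Poset

module _ {k : ℕ} (P : Poset k) where
  open Poset P

  elems : List (Fin k)
  elems = allFinL k

  D : Fin k → Vec Bool k
  D x = tabulate (λ y → y ≺ x)

  U : Fin k → Vec Bool k
  U x = tabulate (λ y → x ≺ y)

  comparableB : Fin k → Fin k → Bool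
  comparableB x y = (x ≺ y) ∨ (y ≺ x)

  Incomp : Fin k → Fin k → Set
  Incomp x y = ¬ (x ≡ y) × (x ≺ y) ≡ false × (y ≺ x) ≡ false

  IsIntervalOrder : Set
  IsIntervalOrder = ¬ (∃ λ a → ∃ λ b → ∃ λ c → ∃ λ d →
      (a ≺ b) ≡ true × (c ≺ d) ≡ true ×
      Incomp a c × Incomp a d × Incomp b c × Incomp b d)

  IsPrimitive : Set
  IsPrimitive = ∀ x y → D x ≡ D y → U x ≡ U y → x ≡ y

  isIsolated isMinimal isMaximal : Fin k → Bool
  isIsolated x = not (any (comparableB x) elems)
  isMinimal  x = not (any (λ y → y ≺ x) elems)
  isMaximal  x = not (any (λ y → x ≺ y) elems)

  mag : ℕ
  mag = length (deduplicate (≡-dec _≟B_) (map D elems))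

  iso# min# max# int# : ℕ
  iso# = length (filterᵇ isIsolated elems)
  min# = length (filterᵇ (λ x → isMinimal x ∧ not (isIsolated x)) elems)
  max# = length (filterᵇ (λ x → isMaximal x ∧ not (isIsolated x)) elems)
  int# = length (filterᵇ (λ x → not (isMinimal x) ∧ not (isMaximal x)) elems)

_≅_ : FinPoset → FinPoset → Set
(k , P) ≅ (l , Q) = Σ (Fin k ↔ Fin l) λ f →
  ∀ x y → Poset._≺_ P x y ≡ Poset._≺_ Q (Inverse.to f x) (Inverse.to f y)

-- "L is a complete list of representatives of the isomorphism classes of
-- finite posets satisfying Q", so that length L = number of such classes
IsoClassReps : (FinPoset → Set) → List FinPoset → Set
IsoClassReps Q L =
  AllL Q L × AllPairs (λ P R → ¬ (P ≅ R)) L ×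
  (∀ P → Q P → AnyL (λ R → P ≅ R) L)

-- Formal power series in (t,v,w,x,y) with integer coefficients,
-- as coefficient functions (exponent of t, v, w, x, y) ↦ coefficient

FPS : Set
FPS = ℕ → ℕ → ℕ → ℕ → ℕ → ℤ

Σ≤ : ℕ → (ℕ → ℤ) → ℤ
Σ≤ zero    f = f 0
Σ≤ (suc n) f = Σ≤ n f ℤ.+ f (suc n)

mono : ℕ → ℕ → ℕ → ℕ → ℕ → FPS
mono a b c d e a' b' c' d' e' =
  if (a ≡ᵇ a') ∧ (b ≡ᵇ b') ∧ (c ≡ᵇ c') ∧ (d ≡ᵇ d') ∧ (e ≡ᵇ e') then 1ℤ else 0ℤ

oneS T Vv W X Y : FPS
oneS = mono 0 0 0 0 0
T    = mono 1 0 0 0 0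
Vv   = mono 0 1 0 0 0
W    = mono 0 0 1 0 0
X    = mono 0 0 0 1 0
Y    = mono 0 0 0 0 1

_⊕_ : FPS → FPS → FPS
(F ⊕ G) a b c d e = F a b c d e ℤ.+ G a b c d e

negS : FPS → FPS
negS F a b c d e = ℤ.- F a b c d e

_⊖_ : FPS → FPS → FPS
F ⊖ G = F ⊕ negS G

_⊗_ : FPS → FPS → FPS
(F ⊗ G) a b c d e =
  Σ≤ a λ i → Σ≤ b λ j → Σ≤ c λ k → Σ≤ d λ l → Σ≤ e λ m →
    F i j k l m ℤ.* G (a ∸ i) (b ∸ j) (c ∸ k) (d ∸ l) (e ∸ m)

powS : FPS → ℕ → FPS
powS F zero    = oneS
powS F (suc n) = F ⊗ powS F n

prodS : ℕ → (ℕ → FPS) → FPS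
prodS zero    f = oneS
prodS (suc n) f = prodS n f ⊗ f n

-- 1/(1 + t G) = Σ_{k≥0} (-tG)^k ; only k ≤ (t-exponent) contribute
inv1+t : FPS → FPS
inv1+t G a b c d e = Σ≤ a λ k → powS (negS (T ⊗ G)) k a b c d e

Vpoly : ℕ → FPS → FPS → FPS
Vpoly n A B = ((A ⊕ oneS) ⊗ powS (B ⊕ oneS) n) ⊖ oneS

rhsTerm : ℕ → FPS
rhsTerm n =
  powS T (suc n) ⊗ ((Vpoly n X Y ⊗ inv1+t (Vpoly n Vv W)) ⊗
    prodS n (λ i → Vpoly i Vv W ⊗ inv1+t (Vpoly i Vv W)))

-- Σ_{n≥0} rhsTerm n ; the n-th term is divisible by t^{n+1},
-- so only n ≤ (t-exponent) contribute to a coefficient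
rhs : FPS
rhs a b c d e = Σ≤ a λ n → rhsTerm n a b c d e

-- The class counted by P(t,v,w,x,y), at the monomial
-- t^a v^b w^c x^d y^e : non-empty primitive interval orders with
-- mag = a, max = b, int = c, iso = d, min = e

CountedAt : ℕ → ℕ → ℕ → ℕ → ℕ → FinPoset → Set
CountedAt a b c d e (k , P) =
  (0 ℕ.< k) × IsIntervalOrder P × IsPrimitive P ×
  mag P ≡ a × max# P ≡ b × int# P ≡ c × iso# P ≡ d × min# P ≡ e

{-# OPTIONS --safe #-}

module Submission where

-- A primitive interval order of magnitude m + 1 is the same thing as an upper triangular 0/1 matrix of size
-- m + 1 without zero rows or columns: the 1-cells are the elements, and one element precedes another when the
-- column of the first lies strictly left of the row of the second.  Minimal elements are the cells of the top
-- row, maximal ones those of the last column.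
--
-- The matrices are counted row by row from the bottom.  Inclusion-exclusion over the set S of columns forced to
-- be zero removes the condition on columns: a nonempty row with n + 1 columns outside S contributes V_n, every
-- new column either joins S (with sign -1) or raises n.  Collecting the rows with the same n into geometric
-- series turns the signed sum into the products of V_i / (1 + t V_i).

open import Defs
open import Algebra.Bundles using (CommutativeRing)
import Algebra.Properties.CommutativeSemigroup as CommutativeSemigroupProperties
import Algebra.Properties.Ring as RingProperties
import Algebra.Solver.Ring.NaturalCoefficients.Default as SemiringSolver
open import Data.Bool using (Bool; true; false; if_then_else_; _∧_; _∨_; not)
open import Data.Bool.ListAction using (any)
import Data.Bool.Properties as 𝔹ₚ
open import Data.Fin using (Fin; toℕ; fromℕ<; punchOut)
import Data.Fin.Properties as Finₚ
open import Data.Integer using (ℤ; +_; 0ℤ; 1ℤ)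
import Data.Integer as ℤ
import Data.Integer.Properties as ℤₚ
open import Data.List using (List; []; _∷_; _++_; map; length; filter; filterᵇ; deduplicate; lookup; tabulate; cartesianProduct; cartesianProductWith)
import Data.List.Properties as Listₚ
open import Data.List.Membership.Propositional using (_∈_; lose)
import Data.List.Membership.Propositional.Properties as ∈ₚ
open import Data.List.Membership.Propositional.Properties.WithK using (unique∧set⇒bag)
open import Data.List.Relation.Binary.BagAndSetEquality using (∼bag⇒↭)
open import Data.List.Relation.Binary.Permutation.Propositional using (_↭_)
import Data.List.Relation.Binary.Permutation.Propositional.Properties as ↭ₚ
import Data.List.Relation.Unary.All as All
open All using (All)
import Data.List.Relation.Unary.All.Properties as Allₚ
open import Data.List.Relation.Unary.AllPairs using (AllPairs; []; _∷_)
open import Data.List.Relation.Unary.Any using (Any; here; there; index)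
import Data.List.Relation.Unary.Any.Properties as Anyₚ
open import Data.List.Relation.Unary.Unique.Propositional using (Unique)
import Data.List.Relation.Unary.Unique.Propositional.Properties as Uniqueₚ
import Data.List.Relation.Unary.Unique.DecPropositional.Properties as UniqueDecₚ
open import Data.Nat using (ℕ; zero; suc; _∸_; _≡ᵇ_; _<ᵇ_; _≤_; _<_; z≤n; s≤s)
import Data.Nat as ℕ
import Data.Nat.Properties as ℕₚ
open import Data.Product using (∃; _×_; _,_; proj₁; proj₂)
open import Data.Sum using (_⊎_; inj₁; inj₂; [_,_]′)
open import Data.Vec using (Vec; []; _∷_; zipWith; replicate)
import Data.Vec as Vec
import Data.Vec.Properties as Vecₚ
open import Function using (_∘_; id)
open import Function.Bundles using (Inverse; Equivalence; mk⇔; mk↔ₛ′)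
open import Level using (Level; 0ℓ)
open import Relation.Binary.Definitions using (tri<; tri≈; tri>)
open import Relation.Binary.PropositionalEquality using (_≡_; _≢_)
import Relation.Binary.PropositionalEquality as ≡
import Relation.Binary.Reasoning.Setoid as SetoidReasoning
open import Relation.Nullary using (¬_; Dec; yes; no; does; contradiction)
open import Relation.Nullary.Decidable using (_×-dec_; dec-true)
open import Relation.Unary using (Decidable)

-- V_n is the weight of all rows with a free last entry and n further free entries, minus the zero
-- row. The last column never joins S, as the bottom row has no entry elsewhere; hence n + 1 columns
-- go with the index n. The signed sum sees S only through its size, so the number n is the whole
-- state of the count. Pairing the weight of the rows already placed (`e`) with that of the rows
-- still to come (`Z`) identifies the sum with a coefficient of a rational function of t over the
-- series in the other four variables.
--
-- On the order side the obstacle is counting up to isomorphism: the matrix has to be recovered from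
-- the bare order. Strict down-sets form a chain; the row of an element is the rank of its down-set
-- and its column is the number of down-sets containing it. As no row or column is empty, these
-- numbers are forced by the order, so isomorphic posets have equal matrices; primitivity makes
-- every entry at most 1.

private variable
  c ℓ : Level
  A B : Set
  r n : ℕ

-- Power series

module Series (R : CommutativeRing c ℓ) where
  open CommutativeRing R hiding (zero)
  open SetoidReasoning setoid
  private module +CS = CommutativeSemigroupProperties +-commutativeSemigroup

  tail : (ℕ → Carrier) → ℕ → Carrier
  tail f n = f (suc n)

  infixl 7 _⊛_
  -- Recursion on the first factor avoids the subtraction of the usual convolution, so the ring
  -- axioms follow by plain induction on the exponent.
  _⊛_ : (ℕ → Carrier) → (ℕ → Carrier) → ℕ → Carrier
  (f ⊛ g) zero    = f 0 * g 0
  (f ⊛ g) (suc n) = f 0 * g (suc n) + (tail f ⊛ g) n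

  infix 4 _≗_
  _≗_ : (f g : ℕ → Carrier) → Set ℓ
  f ≗ g = ∀ n → f n ≈ g n

  _⊞_ : (ℕ → Carrier) → (ℕ → Carrier) → ℕ → Carrier
  (f ⊞ g) n = f n + g n

  constant : Carrier → ℕ → Carrier
  constant a zero    = a
  constant a (suc n) = 0#

  ⊛-cong : ∀ {f f′ g g′} → f ≗ f′ → g ≗ g′ → f ⊛ g ≗ f′ ⊛ g′
  ⊛-cong p q zero    = *-cong (p 0) (q 0)
  ⊛-cong p q (suc n) = +-cong (*-cong (p 0) (q (suc n))) (⊛-cong (λ i → p (suc i)) q n)

  ⊛-distribʳ : ∀ h f g → (f ⊞ g) ⊛ h ≗ (f ⊛ h) ⊞ (g ⊛ h)
  ⊛-distribʳ h f g zero    = distribʳ _ _ _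
  ⊛-distribʳ h f g (suc n) =
    trans (+-cong (distribʳ _ _ _) (⊛-distribʳ h (tail f) (tail g) n)) (+CS.interchange _ _ _ _)

  ⊛-scale : ∀ a f g → (λ n → a * f n) ⊛ g ≗ (λ n → a * (f ⊛ g) n)
  ⊛-scale a f g zero    = *-assoc _ _ _
  ⊛-scale a f g (suc n) =
    trans (+-cong (*-assoc _ _ _) (⊛-scale a (tail f) g n)) (sym (distribˡ _ _ _))

  -- Peeling the convolution from its other end is what lets commutativity go through by induction.
  ⊛-suc-last : ∀ f g n → (f ⊛ g) (suc n) ≈ (f ⊛ tail g) n + f (suc n) * g 0
  ⊛-suc-last f g zero    = refl
  ⊛-suc-last f g (suc n) =
    trans (+-congˡ (⊛-suc-last (tail f) g n)) (sym (+-assoc _ _ _))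

  ⊛-comm : ∀ f g → f ⊛ g ≗ g ⊛ f
  ⊛-comm f g zero    = *-comm _ _
  ⊛-comm f g (suc n) = begin
    (f ⊛ g) (suc n)                 ≈⟨ ⊛-suc-last f g n ⟩
    (f ⊛ tail g) n + f (suc n) * g 0 ≈⟨ +-cong (⊛-comm f (tail g) n) (*-comm _ _) ⟩
    (tail g ⊛ f) n + g 0 * f (suc n) ≈⟨ +-comm _ _ ⟩
    (g ⊛ f) (suc n)                 ∎

  ⊛-assoc : ∀ f g h → (f ⊛ g) ⊛ h ≗ f ⊛ (g ⊛ h)
  ⊛-assoc f g h zero    = *-assoc _ _ _
  ⊛-assoc f g h (suc n) = begin
    f 0 * g 0 * h (suc n) + (((λ i → f 0 * tail g i) ⊞ (tail f ⊛ g)) ⊛ h) n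
      ≈⟨ +-cong (*-assoc _ _ _) (⊛-distribʳ h (λ i → f 0 * tail g i) (tail f ⊛ g) n) ⟩
    f 0 * (g 0 * h (suc n)) + (((λ i → f 0 * tail g i) ⊛ h) n + ((tail f ⊛ g) ⊛ h) n)
      ≈⟨ +-congˡ (+-cong (⊛-scale (f 0) (tail g) h n) (⊛-assoc (tail f) g h n)) ⟩
    f 0 * (g 0 * h (suc n)) + (f 0 * (tail g ⊛ h) n + (tail f ⊛ (g ⊛ h)) n)
      ≈⟨ +-assoc _ _ _ ⟨
    f 0 * (g 0 * h (suc n)) + f 0 * (tail g ⊛ h) n + (tail f ⊛ (g ⊛ h)) n
      ≈⟨ +-congʳ (distribˡ _ _ _) ⟨
    (f ⊛ (g ⊛ h)) (suc n) ∎

  ⊛-zeroˡ : ∀ g → (λ _ → 0#) ⊛ g ≗ (λ _ → 0#)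
  ⊛-zeroˡ g zero    = zeroˡ _
  ⊛-zeroˡ g (suc n) = trans (+-cong (zeroˡ _) (⊛-zeroˡ g n)) (+-identityˡ _)

  constant-⊛ : ∀ a g → constant a ⊛ g ≗ (λ n → a * g n)
  constant-⊛ a g zero    = refl
  constant-⊛ a g (suc n) = trans (+-congˡ (⊛-zeroˡ g n)) (+-identityʳ _)

  ⊛-identityˡ : ∀ g → constant 1# ⊛ g ≗ g
  ⊛-identityˡ g n = trans (constant-⊛ 1# g n) (*-identityˡ _)

  -- The result is again a commutative ring, so iterating the construction supplies the five
  -- variables one at a time.
  seriesRing : CommutativeRing c ℓ
  seriesRing = record
    { Carrier = ℕ → Carrier
    ; _≈_ = _≗_
    ; _+_ = _⊞_
    ; _*_ = _⊛_
    ; -_ = λ f n → - f n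
    ; 0# = λ _ → 0#
    ; 1# = constant 1#
    ; isCommutativeRing = record
      { isRing = record
        { +-isAbelianGroup = record
          { isGroup = record
            { isMonoid = record
              { isSemigroup = record
                { isMagma = record
                  { isEquivalence = record
                    { refl = λ _ → refl
                    ; sym = λ p n → sym (p n)
                    ; trans = λ p q n → trans (p n) (q n)
                    }
                  ; ∙-cong = λ p q n → +-cong (p n) (q n)
                  }
                ; assoc = λ _ _ _ _ → +-assoc _ _ _
                }
              ; identity = (λ _ _ → +-identityˡ _) , (λ _ _ → +-identityʳ _)
              }
            ; inverse = (λ _ _ → -‿inverseˡ _) , (λ _ _ → -‿inverseʳ _)
            ; ⁻¹-cong = λ p n → -‿cong (p n)
            }
          ; comm = λ _ _ _ → +-comm _ _
          }
        ; *-cong = ⊛-cong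
        ; *-assoc = ⊛-assoc
        ; *-identity = ⊛-identityˡ ,
            (λ f n → trans (⊛-comm f (constant 1#) n) (⊛-identityˡ f n))
        ; distrib =
            (λ f g h n → trans (⊛-comm f (g ⊞ h) n) (trans (⊛-distribʳ f g h n)
              (+-cong (⊛-comm g f n) (⊛-comm h f n))))
            , ⊛-distribʳ
        }
      ; *-comm = ⊛-comm
      }
    }

-- Matrices

-- The entry in the last column is kept apart from the n other entries, which are listed from the diagonal to
-- the right; an entry at the head of a vector of length suc j lies in column suc j, counted from the right.
Row : ℕ → Set
Row n = Bool × Vec Bool n

-- Rows are listed from the bottom: Tri r n consists of r + 1 rows with n + 1, ..., n + r + 1 entries, and the
-- triangular matrices of size m + 1 are Tri m 0.
data Tri : ℕ → ℕ → Set where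
  top : ∀ {n} → Row n → Tri 0 n
  _▹_ : ∀ {r n} → Row n → Tri r (suc n) → Tri (suc r) n

infixr 6 _∨ᵥ_
_∨ᵥ_ : ∀ {n} → Vec Bool n → Vec Bool n → Vec Bool n
_∨ᵥ_ = zipWith _∨_

anyTrue allTrue : ∀ {n} → Vec Bool n → Bool
anyTrue []      = false
anyTrue (b ∷ v) = b ∨ anyTrue v
allTrue []      = true
allTrue (b ∷ v) = b ∧ allTrue v

nonempty : ∀ {n} → Row n → Bool
nonempty (l , ρ) = l ∨ anyTrue ρ

-- The flags record which columns (other than the last) are already nonzero.  The last column needs no flag:
-- it contains the only entry of the bottom row.
valid : ∀ {r n} → Vec Bool n → Tri r n → Bool
valid fl (top (l , ρ)) = nonempty (l , ρ) ∧ allTrue (fl ∨ᵥ ρ)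
valid fl ((l , ρ) ▹ M) = nonempty (l , ρ) ∧ valid (false ∷ (fl ∨ᵥ ρ)) M

bools : List Bool
bools = true ∷ false ∷ []

allVecs : ∀ n → List (Vec Bool n)
allVecs zero    = [] ∷ []
allVecs (suc n) = cartesianProductWith _∷_ bools (allVecs n)

allRows : ∀ n → List (Row n)
allRows n = cartesianProduct bools (allVecs n)

allTris : ∀ r n → List (Tri r n)
allTris zero    n = map top (allRows n)
allTris (suc r) n = cartesianProductWith _▹_ (allRows n) (allTris r (suc n))

bit : Bool → ℕ
bit b = if b then 1 else 0

countTrue : ∀ {n} → Vec Bool n → ℕ
countTrue []      = 0
countTrue (b ∷ v) = bit b ℕ.+ countTrue v

rowCount : ∀ {n} → Bool → Row n → ℕ
rowCount isLast (l , ρ) = if isLast then bit l else countTrue ρ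

-- The pairs (isTop , isLast) single out the contributions to max (false , true), int (false , false),
-- iso (true , true) and min (true , false).
cellCount : ∀ {r n} → Bool → Bool → Tri r n → ℕ
cellCount isTop isLast (top ρ) = if isTop then rowCount isLast ρ else 0
cellCount isTop isLast (ρ ▹ M) = (if isTop then 0 else rowCount isLast ρ) ℕ.+ cellCount isTop isLast M

hasStats : ℕ → ℕ → ℕ → ℕ → ∀ {r n} → Tri r n → Bool
hasStats b c d e M = (cellCount false true M ≡ᵇ b) ∧ (cellCount false false M ≡ᵇ c) ∧
                     (cellCount true true M ≡ᵇ d) ∧ (cellCount true false M ≡ᵇ e)

-- Signed counting of matrices by inclusion-exclusion, over any commutative ring

module RingLemmas (R : CommutativeRing c ℓ) where
  open CommutativeRing R hiding (zero)
  open SetoidReasoning setoid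
  open SemiringSolver commutativeSemiring using (solve; _:=_; _:+_; _:*_; con)
  open RingProperties ring using (-‿distribʳ-*; -‿distribˡ-*; -‿+-comm)

  pow : Carrier → ℕ → Carrier
  pow a zero    = 1#
  pow a (suc n) = a * pow a n

  prod : ℕ → (ℕ → Carrier) → Carrier
  prod zero    f = 1#
  prod (suc n) f = prod n f * f n

  sum≤ : ℕ → (ℕ → Carrier) → Carrier
  sum≤ zero    f = f 0
  sum≤ (suc n) f = sum≤ n f + f (suc n)

  pow-cong : ∀ {a b} n → a ≈ b → pow a n ≈ pow b n
  pow-cong zero    p = refl
  pow-cong (suc n) p = *-cong p (pow-cong n p)

  sum≤-cong : ∀ {f g} n → (∀ i → f i ≈ g i) → sum≤ n f ≈ sum≤ n g
  sum≤-cong zero    p = p 0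
  sum≤-cong (suc n) p = +-cong (sum≤-cong n p) (p (suc n))

  sum≤-+ : ∀ f g n → sum≤ n (λ i → f i + g i) ≈ sum≤ n f + sum≤ n g
  sum≤-+ f g zero    = refl
  sum≤-+ f g (suc n) = trans (+-congʳ (sum≤-+ f g n))
    (solve 4 (λ a b c d → (a :+ b) :+ (c :+ d) := (a :+ c) :+ (b :+ d)) refl _ _ _ _)

  sum≤-front : ∀ n f → sum≤ (suc n) f ≈ f 0 + sum≤ n (λ i → f (suc i))
  sum≤-front zero    f = refl
  sum≤-front (suc n) f = trans (+-congʳ (sum≤-front n f)) (+-assoc _ _ _)

  V : ℕ → Carrier → Carrier → Carrier
  V n a b = (a + 1#) * pow (b + 1#) n + - 1#

  sumL : List A → (A → Carrier) → Carrier
  sumL []       f = 0#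
  sumL (x ∷ xs) f = f x + sumL xs f

  sumL-cong : ∀ (xs : List A) {f g} → (∀ x → f x ≈ g x) → sumL xs f ≈ sumL xs g
  sumL-cong []       p = refl
  sumL-cong (x ∷ xs) p = +-cong (p x) (sumL-cong xs p)

  sumL-++ : ∀ (xs ys : List A) f → sumL (xs ++ ys) f ≈ sumL xs f + sumL ys f
  sumL-++ []       ys f = sym (+-identityˡ _)
  sumL-++ (x ∷ xs) ys f = trans (+-congˡ (sumL-++ xs ys f)) (sym (+-assoc _ _ _))

  sumL-map : ∀ {A B : Set} (h : A → B) xs f → sumL (map h xs) f ≈ sumL xs (λ x → f (h x))
  sumL-map h []       f = refl
  sumL-map h (x ∷ xs) f = +-congˡ (sumL-map h xs f)

  sumL-product : ∀ {A B C : Set} (h : A → B → C) xs ys f →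
    sumL (cartesianProductWith h xs ys) f ≈ sumL xs (λ x → sumL ys (λ y → f (h x y)))
  sumL-product h []       ys f = refl
  sumL-product h (x ∷ xs) ys f =
    trans (sumL-++ (map (h x) ys) _ f) (+-cong (sumL-map (h x) ys f) (sumL-product h xs ys f))

  sumL-scale : ∀ a (xs : List A) f → sumL xs (λ x → a * f x) ≈ a * sumL xs f
  sumL-scale a []       f = sym (zeroʳ a)
  sumL-scale a (x ∷ xs) f = trans (+-congˡ (sumL-scale a xs f)) (sym (distribˡ _ _ _))

  sumL-0 : ∀ (xs : List A) → sumL xs (λ _ → 0#) ≈ 0#
  sumL-0 []       = refl
  sumL-0 (x ∷ xs) = trans (+-identityˡ _) (sumL-0 xs)

  -- The effect of one more column: outside S it raises the index, inside S it leaves the index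
  -- alone and costs a sign.
  Δ : (ℕ → Carrier) → ℕ → Carrier
  Δ ψ n = ψ (suc n) + - ψ n

  -- alt ψ fl is the sum of (-1)^|S| ψ (n - |S|) over all sets S of columns with flag false.
  alt : ∀ {n} → (ℕ → Carrier) → Vec Bool n → Carrier
  alt ψ []           = ψ 0
  alt ψ (true ∷ fl)  = alt (λ n → ψ (suc n)) fl
  alt ψ (false ∷ fl) = alt (Δ ψ) fl

  alt-cong : ∀ {n ψ χ} (fl : Vec Bool n) → (∀ i → ψ i ≈ χ i) → alt ψ fl ≈ alt χ fl
  alt-cong []           p = p 0
  alt-cong (true ∷ fl)  p = alt-cong fl (λ i → p (suc i))
  alt-cong (false ∷ fl) p = alt-cong fl (λ i → +-cong (p (suc i)) (-‿cong (p i)))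

  alt-+ : ∀ {n} ψ χ (fl : Vec Bool n) → alt ψ fl + alt χ fl ≈ alt (λ i → ψ i + χ i) fl
  alt-+ ψ χ []           = refl
  alt-+ ψ χ (true ∷ fl)  = alt-+ _ _ fl
  alt-+ ψ χ (false ∷ fl) = trans (alt-+ _ _ fl) (alt-cong fl λ i →
    trans (solve 4 (λ a b c d → (a :+ b) :+ (c :+ d) := (a :+ c) :+ (b :+ d)) refl _ _ _ _)
          (+-congˡ (-‿+-comm _ _)))

  alt-scale : ∀ {n} a ψ (fl : Vec Bool n) → a * alt ψ fl ≈ alt (λ i → a * ψ i) fl
  alt-scale a ψ []           = refl
  alt-scale a ψ (true ∷ fl)  = alt-scale a _ fl
  alt-scale a ψ (false ∷ fl) = trans (alt-scale a _ fl) (alt-cong fl λ i →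
    trans (distribˡ _ _ _) (+-congˡ (sym (-‿distribʳ-* _ _))))

  alt-0 : ∀ {n} (fl : Vec Bool n) → alt (λ _ → 0#) fl ≈ 0#
  alt-0 fl = trans (sym (trans (alt-scale 0# (λ _ → 0#) fl) (alt-cong fl (λ _ → zeroˡ _)))) (zeroˡ _)

  indicator : Bool → Carrier
  indicator b = if b then 1# else 0#

  -- A single `false` takes the difference of a constant and so kills the whole sum.
  allTrue-alt : ∀ {n} (fl : Vec Bool n) → indicator (allTrue fl) ≈ alt (λ _ → 1#) fl
  allTrue-alt []           = refl
  allTrue-alt (true ∷ fl)  = allTrue-alt fl
  allTrue-alt (false ∷ fl) = sym (trans (alt-cong fl (λ _ → -‿inverseʳ 1#)) (alt-0 fl))

  bitWt : Carrier → Bool → Carrier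
  bitWt a b = if b then a else 1#

  vecWt : ∀ {n} → Carrier → Vec Bool n → Carrier
  vecWt a []      = 1#
  vecWt a (b ∷ ρ) = bitWt a b * vecWt a ρ

  rowWt : ∀ {n} → Carrier → Carrier → Row n → Carrier
  rowWt a b (l , ρ) = bitWt a l * vecWt b ρ

  -- Exchange the sums over ρ and S: for fixed S the entries in S vanish and each of the i others is
  -- free, contributing b + 1. In the induction, filling a column whose flag is `false` sets the
  -- flag, while leaving it empty keeps the difference; the two recombine into the difference of the
  -- product.
  sum-vecs : ∀ {n} b ψ (fl : Vec Bool n) →
    sumL (allVecs n) (λ ρ → vecWt b ρ * alt ψ (fl ∨ᵥ ρ)) ≈ alt (λ i → pow (b + 1#) i * ψ i) fl
  sum-vecs b ψ [] = +-identityʳ _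
  sum-vecs {suc n} b ψ (h ∷ fl) = begin
    sumL (allVecs (suc n)) (λ ρ → vecWt b ρ * alt ψ ((h ∷ fl) ∨ᵥ ρ))
      ≈⟨ sumL-product _∷_ bools (allVecs n) _ ⟩
    sumL bools (λ β → sumL (allVecs n) (λ ρ → bitWt b β * vecWt b ρ * alt ψ ((h ∷ fl) ∨ᵥ (β ∷ ρ))))
      ≈⟨ sumL-cong bools (λ β → trans
           (sumL-cong (allVecs n) (λ ρ → *-assoc (bitWt b β) (vecWt b ρ) (alt ψ ((h ∷ fl) ∨ᵥ (β ∷ ρ)))))
           (sumL-scale (bitWt b β) (allVecs n) _)) ⟩
    b * Σρ true + (1# * Σρ false + 0#)
      ≈⟨ solve 3 (λ b x y → b :* x :+ (con 1 :* y :+ con 0) := b :* x :+ y) refl _ _ _ ⟩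
    b * Σρ true + Σρ false
      ≈⟨ go h ⟩
    alt (λ i → pow (b + 1#) i * ψ i) (h ∷ fl) ∎
    where
    Σρ : Bool → Carrier
    Σρ β = sumL (allVecs n) (λ ρ → vecWt b ρ * alt ψ ((h ∷ fl) ∨ᵥ (β ∷ ρ)))
    p = pow (b + 1#)
    go : ∀ h → b * sumL (allVecs n) (λ ρ → vecWt b ρ * alt ψ ((h ∷ fl) ∨ᵥ (true ∷ ρ)))
             + sumL (allVecs n) (λ ρ → vecWt b ρ * alt ψ ((h ∷ fl) ∨ᵥ (false ∷ ρ)))
           ≈ alt (λ i → p i * ψ i) (h ∷ fl)
    go true = begin
      _ ≈⟨ +-cong (*-congˡ (sum-vecs b _ fl)) (sum-vecs b _ fl) ⟩
      b * alt (λ i → p i * ψ (suc i)) fl + alt (λ i → p i * ψ (suc i)) fl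
        ≈⟨ +-congʳ (alt-scale b _ fl) ⟩
      _ ≈⟨ alt-+ _ _ fl ⟩
      _ ≈⟨ alt-cong fl (λ i → solve 3 (λ b p x → b :* (p :* x) :+ p :* x := (b :+ con 1) :* p :* x) refl _ _ _) ⟩
      alt (λ i → p (suc i) * ψ (suc i)) fl ∎
    go false = begin
      _ ≈⟨ +-cong (*-congˡ (sum-vecs b _ fl)) (sum-vecs b _ fl) ⟩
      b * alt (λ i → p i * ψ (suc i)) fl + alt (λ i → p i * Δ ψ i) fl
        ≈⟨ +-congʳ (alt-scale b _ fl) ⟩
      _ ≈⟨ alt-+ _ _ fl ⟩
      _ ≈⟨ alt-cong fl (λ i → trans
             (solve 4 (λ b p x y → b :* (p :* x) :+ p :* (x :+ y) := (b :+ con 1) :* p :* x :+ p :* y) refl _ _ _ _)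
             (+-congˡ (sym (-‿distribʳ-* _ _)))) ⟩
      alt (Δ (λ i → p i * ψ i)) fl ∎

  sum-anyTrue : ∀ {n} (g : Vec Bool n → Carrier) →
    sumL (allVecs n) (λ ρ → if anyTrue ρ then g ρ else 0#) + g (replicate n false) ≈ sumL (allVecs n) g
  sum-anyTrue {zero}  g = solve 1 (λ x → (con 0 :+ con 0) :+ x := x :+ con 0) refl _
  sum-anyTrue {suc n} g = begin
    _ ≈⟨ +-congʳ (sumL-product _∷_ bools (allVecs n) _) ⟩
    (s + (s′ + 0#)) + g (replicate (suc n) false)
      ≈⟨ solve 3 (λ a b c → (a :+ (b :+ con 0)) :+ c := a :+ ((b :+ c) :+ con 0)) refl _ _ _ ⟩
    s + ((s′ + g (replicate (suc n) false)) + 0#)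
      ≈⟨ +-congˡ (+-congʳ (sum-anyTrue (λ ρ → g (false ∷ ρ)))) ⟩
    _ ≈⟨ sumL-product _∷_ bools (allVecs n) _ ⟨
    sumL (allVecs (suc n)) g ∎
    where
    s  = sumL (allVecs n) (λ ρ → g (true ∷ ρ))
    s′ = sumL (allVecs n) (λ ρ → if anyTrue ρ then g (false ∷ ρ) else 0#)

  vecWt-none : ∀ n b → vecWt b (replicate n false) ≈ 1#
  vecWt-none zero    b = refl
  vecWt-none (suc n) b = trans (*-identityˡ _) (vecWt-none n b)

  ∨ᵥ-none : ∀ {n} (fl : Vec Bool n) → fl ∨ᵥ replicate n false ≡ fl
  ∨ᵥ-none []           = ≡.refl
  ∨ᵥ-none (true ∷ fl)  = ≡.cong (true ∷_) (∨ᵥ-none fl)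
  ∨ᵥ-none (false ∷ fl) = ≡.cong (false ∷_) (∨ᵥ-none fl)

  private
    cancel : ∀ {x y z} → x + y ≈ z → x ≈ z + - y
    cancel {x} {y} {z} p = begin
      x              ≈⟨ +-identityʳ x ⟨
      x + 0#         ≈⟨ +-congˡ (-‿inverseʳ y) ⟨
      x + (y + - y)  ≈⟨ +-assoc _ _ _ ⟨
      x + y + - y    ≈⟨ +-congʳ p ⟩
      z + - y        ∎

  -- The last entry gives a + 1, the i columns outside S give the power of b + 1, and the excluded
  -- zero row, which changes no flag, gives the - 1 of `V`.
  sum-rows : ∀ {n} a b ψ (fl : Vec Bool n) →
    sumL (allRows n) (λ ρ → if nonempty ρ then rowWt a b ρ * alt ψ (fl ∨ᵥ proj₂ ρ) else 0#)
      ≈ alt (λ i → V i a b * ψ i) fl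
  sum-rows {n} a b ψ fl = begin
    _ ≈⟨ sumL-product _,_ bools (allVecs n) _ ⟩
    sumL (allVecs n) (λ ρ → a * vecWt b ρ * alt ψ (fl ∨ᵥ ρ)) +
      (sumL (allVecs n) (λ ρ → if anyTrue ρ then g ρ else 0#) + 0#)
      ≈⟨ +-cong (trans (sumL-cong (allVecs n) (λ _ → *-assoc _ _ _)) (sumL-scale a (allVecs n) _))
                (trans (+-identityʳ _) (cancel (sum-anyTrue g))) ⟩
    a * S + (sumL (allVecs n) g + - g (replicate n false))
      ≈⟨ +-congˡ (+-cong (sumL-cong (allVecs n) (λ _ → *-congʳ (*-identityˡ _))) (-‿cong g-none)) ⟩
    a * S + (S + - alt ψ fl)
      ≈⟨ +-cong (*-congˡ (sum-vecs b ψ fl)) (+-cong (sum-vecs b ψ fl)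
           (trans (trans (-‿cong (sym (*-identityˡ _))) (-‿distribˡ-* 1# _)) (alt-scale (- 1#) ψ fl))) ⟩
    a * alt (λ i → pow (b + 1#) i * ψ i) fl + (alt (λ i → pow (b + 1#) i * ψ i) fl + alt (λ i → - 1# * ψ i) fl)
      ≈⟨ +-cong (alt-scale a _ fl) (alt-+ _ _ fl) ⟩
    _ ≈⟨ alt-+ _ _ fl ⟩
    _ ≈⟨ alt-cong fl (λ i → solve 4 (λ a p x m → a :* (p :* x) :+ (p :* x :+ m :* x) := ((a :+ con 1) :* p :+ m) :* x) refl _ _ _ _) ⟩
    alt (λ i → V i a b * ψ i) fl ∎
    where
    S = sumL (allVecs n) (λ ρ → vecWt b ρ * alt ψ (fl ∨ᵥ ρ))
    g : Vec Bool n → Carrier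
    g ρ = 1# * vecWt b ρ * alt ψ (fl ∨ᵥ ρ)
    g-none : g (replicate n false) ≈ alt ψ fl
    g-none = trans (*-cong (trans (*-identityˡ _) (vecWt-none n b)) (reflexive (≡.cong (alt ψ) (∨ᵥ-none fl))))
                   (*-identityˡ _)

  module Weights (v w x y : Carrier) where

    wt : ∀ {r n} → Tri r n → Carrier
    wt (top ρ) = rowWt x y ρ
    wt (ρ ▹ M) = rowWt v w ρ * wt M

    -- Signed weight of r + 1 further rows when n + 1 of the present columns are outside S.
    Z : ℕ → ℕ → Carrier
    Z zero    n = V n x y
    Z (suc r) n = V n v w * Δ (Z r) n

    private
      indicator-∧ : ∀ p q z → (if p ∧ q then z else 0#) ≈ (if p then z * indicator q else 0#)
      indicator-∧ true  true  z = sym (*-identityʳ z)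
      indicator-∧ true  false z = sym (zeroʳ z)
      indicator-∧ false q     z = refl

      if-cong : ∀ p {z z′} → z ≈ z′ → (if p then z else 0#) ≈ (if p then z′ else 0#)
      if-cong true  q = q
      if-cong false q = refl

    -- The row above the bottom one opens a new column with flag `false`, and `alt` of a vector
    -- headed by `false` is `alt` of a difference: this is the recursion of `Z`.
    sum-valid : ∀ r {n} (fl : Vec Bool n) →
      sumL (allTris r n) (λ M → if valid fl M then wt M else 0#) ≈ alt (Z r) fl
    sum-valid zero {n} fl = begin
      _ ≈⟨ sumL-map top (allRows n) _ ⟩
      _ ≈⟨ sumL-cong (allRows n) (λ ρ → trans (indicator-∧ (nonempty ρ) _ _)
             (if-cong (nonempty ρ) (*-congˡ (allTrue-alt (fl ∨ᵥ proj₂ ρ))))) ⟩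
      _ ≈⟨ sum-rows x y _ fl ⟩
      _ ≈⟨ alt-cong fl (λ _ → *-identityʳ _) ⟩
      alt (Z zero) fl ∎
    sum-valid (suc r) {n} fl = begin
      _ ≈⟨ sumL-product _▹_ (allRows n) (allTris r (suc n)) _ ⟩
      _ ≈⟨ sumL-cong (allRows n) inner ⟩
      _ ≈⟨ sum-rows v w _ fl ⟩
      alt (Z (suc r)) fl ∎
      where
      Ms = allTris r (suc n)
      inner : ∀ ρ → sumL Ms (λ M → if valid fl (ρ ▹ M) then rowWt v w ρ * wt M else 0#)
                  ≈ (if nonempty ρ then rowWt v w ρ * alt (Δ (Z r)) (fl ∨ᵥ proj₂ ρ) else 0#)
      inner ρ with nonempty ρ
      ... | false = sumL-0 Ms
      ... | true  = begin
        _ ≈⟨ sumL-cong Ms pull ⟩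
        _ ≈⟨ sumL-scale _ Ms _ ⟩
        _ ≈⟨ *-congˡ (sum-valid r (false ∷ (fl ∨ᵥ proj₂ ρ))) ⟩
        _ ∎
        where
        pull : ∀ M → (if valid (false ∷ (fl ∨ᵥ proj₂ ρ)) M then rowWt v w ρ * wt M else 0#)
                   ≈ rowWt v w ρ * (if valid (false ∷ (fl ∨ᵥ proj₂ ρ)) M then wt M else 0#)
        pull M with valid (false ∷ (fl ∨ᵥ proj₂ ρ)) M
        ... | true  = refl
        ... | false = sym (zeroʳ _)

  module Monomials
    (mon : ℕ → ℕ → ℕ → ℕ → Carrier) (mon-1 : mon 0 0 0 0 ≈ 1#)
    (mon-* : ∀ i j k l i′ j′ k′ l′ → mon i j k l * mon i′ j′ k′ l′ ≈ mon (i ℕ.+ i′) (j ℕ.+ j′) (k ℕ.+ k′) (l ℕ.+ l′)) where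
    open Weights (mon 1 0 0 0) (mon 0 1 0 0) (mon 0 0 1 0) (mon 0 0 0 1)

    vecWt-power : ∀ (f : ℕ → Carrier) → f 0 ≈ 1# → (∀ i j → f i * f j ≈ f (i ℕ.+ j)) →
      ∀ {n} (ρ : Vec Bool n) → vecWt (f 1) ρ ≈ f (countTrue ρ)
    vecWt-power f f-0 f-+ []          = sym f-0
    vecWt-power f f-0 f-+ (true ∷ ρ)  = trans (*-congˡ (vecWt-power f f-0 f-+ ρ)) (f-+ 1 _)
    vecWt-power f f-0 f-+ (false ∷ ρ) = trans (*-identityˡ _) (vecWt-power f f-0 f-+ ρ)

    bitWt-power : ∀ (f : ℕ → Carrier) → f 0 ≈ 1# → ∀ b → bitWt (f 1) b ≈ f (bit b)
    bitWt-power f f-0 true  = refl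
    bitWt-power f f-0 false = sym f-0

    wt-monomial : ∀ {r n} (M : Tri r n) → wt M ≈
      mon (cellCount false true M) (cellCount false false M) (cellCount true true M) (cellCount true false M)
    wt-monomial (top (l , ρ)) = begin
      _ ≈⟨ *-cong (bitWt-power (λ k → mon 0 0 k 0) mon-1 l)
                  (vecWt-power (λ k → mon 0 0 0 k) mon-1 (λ i j → mon-* 0 0 0 i 0 0 0 j) ρ) ⟩
      mon 0 0 (bit l) 0 * mon 0 0 0 (countTrue ρ)
        ≈⟨ mon-* 0 0 (bit l) 0 0 0 0 (countTrue ρ) ⟩
      mon 0 0 (bit l ℕ.+ 0) (countTrue ρ)
        ≡⟨ ≡.cong (λ k → mon 0 0 k (countTrue ρ)) (ℕₚ.+-identityʳ (bit l)) ⟩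
      mon 0 0 (bit l) (countTrue ρ) ∎
    wt-monomial ((l , ρ) ▹ M) = begin
      _ ≈⟨ *-cong (*-cong (bitWt-power (λ k → mon k 0 0 0) mon-1 l)
                          (vecWt-power (λ k → mon 0 k 0 0) mon-1 (λ i j → mon-* 0 i 0 0 0 j 0 0) ρ))
                  (wt-monomial M) ⟩
      _ ≈⟨ *-congʳ (mon-* (bit l) 0 0 0 0 (countTrue ρ) 0 0) ⟩
      mon (bit l ℕ.+ 0) (countTrue ρ) 0 0 * _
        ≡⟨ ≡.cong (λ k → mon k (countTrue ρ) 0 0 * _) (ℕₚ.+-identityʳ (bit l)) ⟩
      _ ≈⟨ mon-* (bit l) (countTrue ρ) 0 0 _ _ _ _ ⟩
      _ ∎

  -- Agreement on the ring operations extends to every expression built from them, so the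
  -- convolution `_⊗_` needs to be compared with a ring product only once.
  module Transport
    (_~_ : FPS → Carrier → Set)
    (~-one : oneS ~ 1#)
    (~-⊕ : ∀ {F G f g} → F ~ f → G ~ g → (F ⊕ G) ~ (f + g))
    (~-⊗ : ∀ {F G f g} → F ~ f → G ~ g → (F ⊗ G) ~ (f * g))
    (~-neg : ∀ {F f} → F ~ f → negS F ~ (- f)) where

    ~-pow : ∀ {F f} n → F ~ f → powS F n ~ pow f n
    ~-pow zero    p = ~-one
    ~-pow (suc n) p = ~-⊗ p (~-pow n p)

    ~-prod : ∀ {F f} n → (∀ i → F i ~ f i) → prodS n F ~ prod n f
    ~-prod zero    p = ~-one
    ~-prod (suc n) p = ~-⊗ (~-prod n p) (p n)

    ~-V : ∀ n {F G f g} → F ~ f → G ~ g → Vpoly n F G ~ V n f g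
    ~-V n p q = ~-⊕ (~-⊗ (~-⊕ p ~-one) (~-pow n (~-⊕ q ~-one))) (~-neg ~-one)

    ~-term : ∀ n {T₀ A₀ I₀ t a i} {F₀ f} → T₀ ~ t → A₀ ~ a → I₀ ~ i → (∀ i → F₀ i ~ f i) →
      (powS T₀ (suc n) ⊗ ((A₀ ⊗ I₀) ⊗ prodS n F₀)) ~ (pow t (suc n) * ((a * i) * prod n f))
    ~-term n p q r s = ~-⊗ (~-pow (suc n) p) (~-⊗ (~-⊗ q r) (~-prod n s))

-- Monomials and geometric series in one variable

module Single (R : CommutativeRing c ℓ) where
  open CommutativeRing R hiding (zero)
  open Series R
  open RingLemmas R
  private
    module S  = CommutativeRing seriesRing
    module SL = RingLemmas seriesRing
  open RingProperties ring using (-0#≈0#)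

  -- Exponents are tested by `≡ᵇ` as in `mono`, which therefore splits into nested copies of
  -- `single`, one per variable.
  single : ℕ → Carrier → ℕ → Carrier
  single m a n = if m ≡ᵇ n then a else 0#

  tVar : ℕ → Carrier
  tVar = single 1 1#

  single-cong : ∀ m {a b} → a ≈ b → single m a ≗ single m b
  single-cong m p n with m ≡ᵇ n
  ... | true  = p
  ... | false = refl

  single-constant : ∀ a → single 0 a ≗ constant a
  single-constant a zero    = refl
  single-constant a (suc n) = refl

  single-scale : ∀ a n b → (λ k → a * single n b k) ≗ single n (a * b)
  single-scale a n b k with n ≡ᵇ k
  ... | true  = refl
  ... | false = zeroʳ a

  single-neg : ∀ n b → (λ k → - single n b k) ≗ single n (- b)
  single-neg n b k with n ≡ᵇ k
  ... | true  = refl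
  ... | false = -0#≈0#

  single-0-⊛ : ∀ a g → single 0 a ⊛ g ≗ (λ n → a * g n)
  single-0-⊛ a g = S.trans (⊛-cong (single-constant a) (λ _ → refl)) (constant-⊛ a g)

  tVar-⊛-zero : ∀ (g : ℕ → Carrier) → (tVar ⊛ g) 0 ≈ 0#
  tVar-⊛-zero g = zeroˡ _

  tVar-⊛-suc : ∀ g n → (tVar ⊛ g) (suc n) ≈ g n
  tVar-⊛-suc g n = trans (+-cong (zeroˡ _) (trans (single-0-⊛ 1# g n) (*-identityˡ _))) (+-identityˡ _)

  single-⊛ : ∀ m n a b → single m a ⊛ single n b ≗ single (m ℕ.+ n) (a * b)
  single-⊛ zero    n a b = S.trans (single-0-⊛ a (single n b)) (single-scale a n b)
  single-⊛ (suc m) n a b zero    = zeroˡ _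
  single-⊛ (suc m) n a b (suc k) =
    trans (+-cong (zeroˡ _) (single-⊛ m n a b k)) (+-identityˡ _)

  pow-single : ∀ a k → SL.pow (single 1 a) k ≗ single k (pow a k)
  pow-single a zero    = S.sym (single-constant 1#)
  pow-single a (suc k) = S.trans (⊛-cong (λ _ → refl) (pow-single a k)) (single-⊛ 1 k a (pow a k))

  single-< : ∀ k n a → k < n → single k a n ≈ 0#
  single-< zero    (suc n) a _         = refl
  single-< (suc k) (suc n) a (s≤s k<n) = single-< k n a k<n

  single-diag : ∀ n a → single n a n ≈ a
  single-diag zero    a = refl
  single-diag (suc n) a = single-diag n a

  sum-single-< : ∀ (p : ℕ → Carrier) k n → k < n → sum≤ k (λ i → single i (p i) n) ≈ 0#
  sum-single-< p zero    n k<n = single-< 0 n _ k<n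
  sum-single-< p (suc k) n k<n =
    trans (+-cong (sum-single-< p k n (ℕₚ.≤-pred (ℕₚ.m≤n⇒m≤1+n k<n))) (single-< (suc k) n _ k<n)) (+-identityˡ _)

  sum-single : ∀ (p : ℕ → Carrier) n → sum≤ n (λ i → single i (p i) n) ≈ p n
  sum-single p zero    = refl
  sum-single p (suc n) =
    trans (+-cong (sum-single-< p n (suc n) ℕₚ.≤-refl) (single-diag n _)) (+-identityˡ _)

  inv : Carrier → ℕ → Carrier
  inv g n = sum≤ n (λ k → SL.pow (S.- (tVar ⊛ single 0 g)) k n)

  -- The k-th power of - t g lives in degree k alone, so the truncated sum at exponent n retains
  -- just the term k = n.
  inv-geometric : ∀ g → inv g ≗ pow (- g)
  inv-geometric g n =
    trans (sum≤-cong n (λ k → trans (SL.pow-cong k N n) (pow-single (- g) k n)))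
          (sum-single (pow (- g)) n)
    where
    N : (S.- (tVar ⊛ single 0 g)) ≗ single 1 (- g)
    N = S.trans (S.-‿cong (S.trans (single-⊛ 1 0 1# g) (single-cong 1 (*-identityˡ g)))) (single-neg 1 g)

  single-+ : ∀ a b → single 0 a ⊞ single 0 b ≗ single 0 (a + b)
  single-+ a b zero    = refl
  single-+ a b (suc n) = +-identityˡ _

  pow-single-0 : ∀ a n → SL.pow (single 0 a) n ≗ single 0 (pow a n)
  pow-single-0 a zero    = S.sym (single-constant 1#)
  pow-single-0 a (suc n) = S.trans (⊛-cong S.refl (pow-single-0 a n)) (single-⊛ 0 0 a (pow a n))

  V-single : ∀ n a b → SL.V n (single 0 a) (single 0 b) ≗ single 0 (V n a b)
  V-single n a b =
    S.trans (S.+-cong (S.trans (⊛-cong (+1 a) (S.trans (SL.pow-cong n (+1 b)) (pow-single-0 (b + 1#) n)))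
                               (single-⊛ 0 0 (a + 1#) (pow (b + 1#) n)))
                      (S.trans (S.-‿cong (S.sym (single-constant 1#))) (single-neg 0 1#)))
            (single-+ _ _)
    where
    +1 : ∀ a → single 0 a ⊞ constant 1# ≗ single 0 (a + 1#)
    +1 a = S.trans (S.+-cong (S.refl {single 0 a}) (S.sym (single-constant 1#))) (single-+ a 1#)

-- From the row recursion to the product formula

module Signed (R : CommutativeRing c ℓ) (A B : ℕ → CommutativeRing.Carrier R) where
  open CommutativeRing R hiding (zero)
  open Series R
  open RingLemmas R
  open Single R
  open SetoidReasoning setoid
  open SemiringSolver commutativeSemiring using (solve; _:=_; _:+_; _:*_; con)
  open RingProperties ring using (-‿distribˡ-*; -‿distribʳ-*)
  private
    module S  = CommutativeRing seriesRing
    module SL = RingLemmas seriesRing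

  -- Signed weight of the s lowest rows, n + 1 of the first s + 1 columns being outside S: the adjoint
  -- recursion to that of Z, and also the coefficient of t^(s+1) in t/(1 + t B_n) times the product of
  -- t B_i/(1 + t B_i) over i < n (E-coeff below).
  e : ℕ → ℕ → Carrier
  e zero    zero    = 1#
  e zero    (suc n) = 0#
  e (suc s) zero    = - B 0 * e s 0
  e (suc s) (suc n) = B n * e s n + - B (suc n) * e s (suc n)

  -- Each row brings one new column, so n grows by at most one per row.
  e-> : ∀ s n → s < n → e s n ≈ 0#
  e-> zero    (suc n) _         = refl
  e-> (suc s) (suc n) (s≤s s<n) =
    trans (+-cong (trans (*-congˡ (e-> s n s<n)) (zeroʳ _))
                  (trans (*-congˡ (e-> s (suc n) (ℕₚ.m≤n⇒m≤1+n s<n))) (zeroʳ _)))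
          (+-identityˡ _)

  -- Summation by parts: the shifted half of `Δ z` yields the first summand of `e (suc s)`, the
  -- other half the second.
  e-adjoint : ∀ s z →
    sum≤ s (λ n → e s n * (B n * Δ z n)) ≈ sum≤ (suc s) (λ n → e (suc s) n * z n)
  e-adjoint s z = begin
    sum≤ s (λ n → e s n * (B n * Δ z n))
      ≈⟨ sum≤-cong s (λ n → trans
           (solve 4 (λ e b z z′ → e :* (b :* (z :+ z′)) := b :* e :* z :+ b :* z′ :* e) refl _ _ _ _)
           (+-congˡ (trans (*-congʳ (trans (sym (-‿distribʳ-* _ _)) (-‿distribˡ-* _ _)))
             (solve 3 (λ b z e → b :* z :* e := b :* e :* z) refl _ _ _)))) ⟩
    sum≤ s (λ n → F n + G n)
      ≈⟨ sum≤-+ F G s ⟩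
    sum≤ s F + sum≤ s G
      -- The range of the second sum can grow by one because `e s (suc s)` vanishes.
      ≈⟨ +-congˡ (trans (+-congˡ (trans (*-congʳ (trans (*-congˡ (e-> s (suc s) ℕₚ.≤-refl)) (zeroʳ _))) (zeroˡ _)))
                        (+-identityʳ _)) ⟨
    sum≤ s F + sum≤ (suc s) G
      ≈⟨ +-congˡ (sum≤-front s G) ⟩
    sum≤ s F + (G 0 + sum≤ s (λ n → G (suc n)))
      ≈⟨ solve 3 (λ f g h → f :+ (g :+ h) := g :+ (f :+ h)) refl _ _ _ ⟩
    G 0 + (sum≤ s F + sum≤ s (λ n → G (suc n)))
      ≈⟨ +-congˡ (sum≤-+ F _ s) ⟨
    G 0 + sum≤ s (λ n → F n + G (suc n))
      ≈⟨ +-congˡ (sum≤-cong s (λ n → sym (distribʳ _ _ _))) ⟩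
    G 0 + sum≤ s (λ n → e (suc s) (suc n) * z (suc n))
      ≈⟨ sum≤-front s _ ⟨
    sum≤ (suc s) (λ n → e (suc s) n * z n) ∎
    where
    F G : ℕ → Carrier
    F n = B n * e s n * z (suc n)
    G n = - B n * e s n * z n

  module _ (Z : ℕ → ℕ → Carrier) (Z-zero : ∀ n → Z 0 n ≈ A n)
           (Z-suc : ∀ r n → Z (suc r) n ≈ B n * Δ (Z r) n) where

    -- Rows pass one at a time from the part still to come, weighed by `Z`, to the part below,
    -- weighed by `e`, until only the top row is left.
    transfer : ∀ s r → sum≤ s (λ n → e s n * Z r n) ≈ sum≤ (s ℕ.+ r) (λ n → e (s ℕ.+ r) n * A n)
    transfer s zero    rewrite ℕₚ.+-identityʳ s = sum≤-cong s (λ n → *-congˡ (Z-zero n))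
    transfer s (suc r) rewrite ℕₚ.+-suc s r = begin
      _ ≈⟨ sum≤-cong s (λ n → *-congˡ (Z-suc r n)) ⟩
      _ ≈⟨ e-adjoint s (Z r) ⟩
      _ ≈⟨ transfer (suc s) r ⟩
      _ ∎

    Z-sum : ∀ m → Z m 0 ≈ sum≤ m (λ n → e m n * A n)
    Z-sum m = trans (sym (*-identityˡ _)) (transfer 0 m)

  factor : ℕ → ℕ → Carrier
  factor i = single 0 (B i) ⊛ inv (B i)

  -- `K n` collects the completed factors i < n, each with its own t; `E n` adds the series of the
  -- current n, whose powers count rows that leave n unchanged.
  K E : ℕ → ℕ → Carrier
  K n = SL.pow tVar n ⊛ SL.prod n factor
  E n = tVar ⊛ (inv (B n) ⊛ K n)

  private
    module SS = SemiringSolver S.commutativeSemiring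

  inv-suc : ∀ g n → inv g (suc n) ≈ - g * inv g n
  inv-suc g n = trans (inv-geometric g (suc n)) (*-congˡ (sym (inv-geometric g n)))

  inv-step : ∀ g → inv g ≗ constant 1# ⊞ (tVar ⊛ (single 0 (- g) ⊛ inv g))
  inv-step g zero    = sym (trans (+-congˡ (tVar-⊛-zero (single 0 (- g) ⊛ inv g))) (+-identityʳ _))
  inv-step g (suc n) = trans (inv-suc g n)
    (sym (trans (+-identityˡ _) (trans (tVar-⊛-suc _ n) (single-0-⊛ (- g) (inv g) n))))

  E-step : ∀ n → inv (B n) ⊛ K n ≗ K n ⊞ (single 0 (- B n) ⊛ E n)
  E-step n = S.trans (⊛-cong (inv-step (B n)) (λ _ → refl))
    (SS.solve 4 (λ t b g k → (SS.con 1 SS.:+ t SS.:* (b SS.:* g)) SS.:* k SS.:= k SS.:+ b SS.:* (t SS.:* (g SS.:* k)))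
      S.refl tVar (single 0 (- B n)) (inv (B n)) (K n))

  K-suc : ∀ n → K (suc n) ≗ single 0 (B n) ⊛ E n
  K-suc n = SS.solve 5 (λ t u g b p →
      (t SS.:* u) SS.:* (p SS.:* (b SS.:* g)) SS.:= b SS.:* (t SS.:* (g SS.:* (u SS.:* p))))
    S.refl tVar (SL.pow tVar n) (inv (B n)) (single 0 (B n)) (SL.prod n factor)

  E-suc : ∀ n s → E n (suc s) ≈ K n s + - B n * E n s
  E-suc n s = trans (tVar-⊛-suc _ s) (trans (E-step n s) (+-congˡ (single-0-⊛ (- B n) (E n) s)))

  K-suc-coeff : ∀ n s → K (suc n) s ≈ B n * E n s
  K-suc-coeff n s = trans (K-suc n s) (single-0-⊛ (B n) (E n) s)

  private
    K-zero : ∀ s → K 0 s ≈ constant 1# s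
    K-zero s = ⊛-identityˡ (constant 1#) s

    E-zero-coeff : ∀ n → E n 0 ≈ 0#
    E-zero-coeff n = tVar-⊛-zero (inv (B n) ⊛ K n)

  -- The recursion of `e` splits into entering level n + 1 from level n through `K (suc n)` and
  -- staying there through the geometric series. The shift of the exponent is the extra t in `E`.
  E-coeff : ∀ s n → E n (suc s) ≈ e s n
  E-coeff zero zero = begin
    E 0 1                    ≈⟨ E-suc 0 0 ⟩
    K 0 0 + - B 0 * E 0 0    ≈⟨ +-cong (K-zero 0) (trans (*-congˡ (E-zero-coeff 0)) (zeroʳ _)) ⟩
    1# + 0#                  ≈⟨ +-identityʳ _ ⟩
    1#                       ∎
  E-coeff zero (suc n) = begin
    E (suc n) 1              ≈⟨ E-suc (suc n) 0 ⟩
    K (suc n) 0 + - B (suc n) * E (suc n) 0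
      ≈⟨ +-cong (trans (K-suc-coeff n 0) (trans (*-congˡ (E-zero-coeff n)) (zeroʳ _)))
                (trans (*-congˡ (E-zero-coeff (suc n))) (zeroʳ _)) ⟩
    0# + 0#                  ≈⟨ +-identityˡ _ ⟩
    0#                       ∎
  E-coeff (suc s) zero = begin
    E 0 (suc (suc s))                  ≈⟨ E-suc 0 (suc s) ⟩
    K 0 (suc s) + - B 0 * E 0 (suc s)  ≈⟨ +-cong (K-zero (suc s)) (*-congˡ (E-coeff s 0)) ⟩
    0# + - B 0 * e s 0                 ≈⟨ +-identityˡ _ ⟩
    - B 0 * e s 0                      ∎
  E-coeff (suc s) (suc n) = begin
    E (suc n) (suc (suc s))            ≈⟨ E-suc (suc n) (suc s) ⟩
    K (suc n) (suc s) + - B (suc n) * E (suc n) (suc s)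
      ≈⟨ +-cong (trans (K-suc-coeff n (suc s)) (*-congˡ (E-coeff s n))) (*-congˡ (E-coeff s (suc n))) ⟩
    e (suc s) (suc n)                  ∎

  term : ℕ → ℕ → Carrier
  term n = SL.pow tVar (suc n) ⊛ ((single 0 (A n) ⊛ inv (B n)) ⊛ SL.prod n factor)

  term≗ : ∀ n s → term n s ≈ A n * E n s
  term≗ n s = trans
    (SS.solve 5 (λ t u a g p → (t SS.:* u) SS.:* ((a SS.:* g) SS.:* p) SS.:= a SS.:* (t SS.:* (g SS.:* (u SS.:* p))))
      S.refl tVar (SL.pow tVar n) (single 0 (A n)) (inv (B n)) (SL.prod n factor) s)
    (single-0-⊛ (A n) (E n) s)

  term-zero : term 0 0 ≈ 0#
  term-zero = trans (term≗ 0 0) (trans (*-congˡ (E-zero-coeff 0)) (zeroʳ _))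

  sum-terms : ∀ m → sum≤ (suc m) (λ n → term n (suc m)) ≈ sum≤ m (λ n → e m n * A n)
  sum-terms m = begin
    sum≤ (suc m) (λ n → term n (suc m))
      ≈⟨ sum≤-cong (suc m) (λ n → trans (term≗ n (suc m)) (trans (*-congˡ (E-coeff m n)) (*-comm _ _))) ⟩
    sum≤ m (λ n → e m n * A n) + e m (suc m) * A (suc m)
      -- The range in `rhs` includes n = m + 1, but that term starts only at exponent m + 2.
      ≈⟨ +-congˡ (trans (*-congʳ (e-> m (suc m) ℕₚ.≤-refl)) (zeroˡ _)) ⟩
    sum≤ m (λ n → e m n * A n) + 0#
      ≈⟨ +-identityʳ _ ⟩
    sum≤ m (λ n → e m n * A n) ∎

open import Data.Nat using (_+_)
open ≡ using (refl; cong; cong₂; sym; trans; subst; module ≡-Reasoning)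

-- Reading off integer coefficients

module Coefficient (R : CommutativeRing 0ℓ 0ℓ) (ev : CommutativeRing.Carrier R → ℤ)
  (ev-+ : ∀ x y → ev (CommutativeRing._+_ R x y) ≡ ev x ℤ.+ ev y) where
  open CommutativeRing R using (Carrier; _*_; 0#)
  open Series R
  open RingLemmas R

  Σ≤-front : ∀ n f → Σ≤ (suc n) f ≡ f 0 ℤ.+ Σ≤ n (λ i → f (suc i))
  Σ≤-front zero    f = refl
  Σ≤-front (suc n) f = trans (cong (ℤ._+ f (suc (suc n))) (Σ≤-front n f)) (ℤₚ.+-assoc (f 0) _ _)

  sum≤-ev : ∀ n f → ev (sum≤ n f) ≡ Σ≤ n (λ i → ev (f i))
  sum≤-ev zero    f = refl
  sum≤-ev (suc n) f = trans (ev-+ _ _) (cong (ℤ._+ ev (f (suc n))) (sum≤-ev n f))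

  -- With `ev` fixing the exponents of the inner variables, this turns one layer of ring product
  -- into one `Σ≤` of `_⊗_`.
  ⊛-ev : ∀ f g n → ev ((f ⊛ g) n) ≡ Σ≤ n (λ i → ev (f i * g (n ∸ i)))
  ⊛-ev f g zero    = refl
  ⊛-ev f g (suc n) = trans (ev-+ _ _) (trans (cong (λ z → ev (f 0 * g (suc n)) ℤ.+ z) (⊛-ev (tail f) g n))
    (sym (Σ≤-front n (λ i → ev (f i * g (suc n ∸ i))))))

  count-ev : ∀ {A : Set} (p q : A → Bool) (f : A → Carrier) →
    (∀ x → ev (f x) ≡ (if q x then 1ℤ else 0ℤ)) → ev 0# ≡ 0ℤ →
    ∀ xs → + length (filterᵇ (λ x → p x ∧ q x) xs) ≡ ev (sumL xs (λ x → if p x then f x else 0#))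
  count-ev p q f f-ev 0-ev []       = sym 0-ev
  count-ev p q f f-ev 0-ev (x ∷ xs) = trans head (sym (ev-+ _ _))
    where
    IH = count-ev p q f f-ev 0-ev xs
    head : + length (filterᵇ (λ x → p x ∧ q x) (x ∷ xs)) ≡
           ev (if p x then f x else 0#) ℤ.+ ev (sumL xs (λ x → if p x then f x else 0#))
    head with p x
    ... | false = trans IH (trans (sym (ℤₚ.+-identityˡ _)) (cong₂ ℤ._+_ (sym 0-ev) refl))
    ... | true with q x | f-ev x
    ...   | true  | fx = cong₂ ℤ._+_ (sym fx) IH
    ...   | false | fx = trans IH (trans (sym (ℤₚ.+-identityˡ _)) (cong₂ ℤ._+_ (sym fx) refl))

Σ≤-cong : ∀ n {f g : ℕ → ℤ} → (∀ i → f i ≡ g i) → Σ≤ n f ≡ Σ≤ n g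
Σ≤-cong zero    p = p 0
Σ≤-cong (suc n) p = cong₂ ℤ._+_ (Σ≤-cong n p) (p (suc n))

-- The generating function

-- R₄ is the ring of power series in v, w, x, y, with y innermost; R₅ adjoins t.
R₀ R₁ R₂ R₃ R₄ R₅ : CommutativeRing 0ℓ 0ℓ
R₀ = ℤₚ.+-*-commutativeRing
R₁ = Series.seriesRing R₀
R₂ = Series.seriesRing R₁
R₃ = Series.seriesRing R₂
R₄ = Series.seriesRing R₃
R₅ = Series.seriesRing R₄

module Q₄ = CommutativeRing R₄
module Q₅ = CommutativeRing R₅
module L₄ = RingLemmas R₄
module L₅ = RingLemmas R₅

-- A record rather than a function type, so that F and G can be inferred from a proof of F ≋ G.
infix 4 _≋_
record _≋_ (F G : FPS) : Set where
  constructor pointwise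
  field at : ∀ a b c d e → F a b c d e ≡ G a b c d e
open _≋_

≋-trans : ∀ {F G H} → F ≋ G → G ≋ H → F ≋ H
≋-trans p q = pointwise λ a b c d e → trans (at p a b c d e) (at q a b c d e)

-- The five nested sums are matched from the outside in, one variable per layer of the ring.
⊗≋* : ∀ F G → F ⊗ G ≋ F Q₅.* G
⊗≋* F G = pointwise λ a b c d e → sym (trans (Coefficient.⊛-ev R₄ (λ H → H b c d e) (λ _ _ → refl) F G a)
  (Σ≤-cong a λ i → trans (Coefficient.⊛-ev R₃ (λ H → H c d e) (λ _ _ → refl) (F i) (G (a ∸ i)) b)
  (Σ≤-cong b λ j → trans (Coefficient.⊛-ev R₂ (λ H → H d e) (λ _ _ → refl) (F i j) (G (a ∸ i) (b ∸ j)) c)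
  (Σ≤-cong c λ k → trans (Coefficient.⊛-ev R₁ (λ H → H e) (λ _ _ → refl) (F i j k) (G (a ∸ i) (b ∸ j) (c ∸ k)) d)
  (Σ≤-cong d λ l → Coefficient.⊛-ev R₀ (λ z → z) (λ _ _ → refl) (F i j k l) (G (a ∸ i) (b ∸ j) (c ∸ k) (d ∸ l)) e)))))

oneS≋1 : oneS ≋ Q₅.1#
oneS≋1 = pointwise one
  where
  one : ∀ a b c d e → oneS a b c d e ≡ Q₅.1# a b c d e
  one zero    zero    zero    zero    zero    = refl
  one zero    zero    zero    zero    (suc _) = refl
  one zero    zero    zero    (suc _) _       = refl
  one zero    zero    (suc _) _       _       = refl
  one zero    (suc _) _       _       _       = refl
  one (suc _) _       _       _       _       = refl

⊗-cong : ∀ {F F′ G G′} → F ≋ F′ → G ≋ G′ → F ⊗ G ≋ F′ Q₅.* G′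
⊗-cong {F} {F′} {G} {G′} p q = ≋-trans (⊗≋* F G) (pointwise (Q₅.*-cong {F} {F′} {G} {G′} (at p) (at q)))

⊕-cong : ∀ {F F′ G G′} → F ≋ F′ → G ≋ G′ → F ⊕ G ≋ F′ Q₅.+ G′
⊕-cong p q = pointwise λ a b c d e → cong₂ ℤ._+_ (at p a b c d e) (at q a b c d e)

negS-cong : ∀ {F G} → F ≋ G → negS F ≋ (Q₅.- G)
negS-cong p = pointwise λ a b c d e → cong ℤ.-_ (at p a b c d e)

module Transport₅ = L₅.Transport _≋_ oneS≋1 ⊕-cong ⊗-cong negS-cong

mono₄ : ℕ → ℕ → ℕ → ℕ → Q₄.Carrier
mono₄ i j k l = Single.single R₃ i (Single.single R₂ j (Single.single R₁ k (Single.single R₀ l 1ℤ)))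

mono₄-coeff : ∀ i j k l b c d e →
  mono₄ i j k l b c d e ≡ (if (i ≡ᵇ b) ∧ (j ≡ᵇ c) ∧ (k ≡ᵇ d) ∧ (l ≡ᵇ e) then 1ℤ else 0ℤ)
mono₄-coeff i j k l b c d e with i ≡ᵇ b
... | false = refl
... | true with j ≡ᵇ c
...   | false = refl
...   | true with k ≡ᵇ d
...     | false = refl
...     | true = refl

open Single R₄ using (single; inv) renaming (tVar to T₅)

mono≋ : ∀ h i j k l → mono h i j k l ≋ single h (mono₄ i j k l)
mono≋ h i j k l = pointwise coeff
  where
  coeff : ∀ a b c d e → mono h i j k l a b c d e ≡ single h (mono₄ i j k l) a b c d e
  coeff a b c d e with h ≡ᵇ a
  ... | false = refl
  ... | true  = sym (mono₄-coeff i j k l b c d e)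

v w x y : Q₄.Carrier
v = mono₄ 1 0 0 0
w = mono₄ 0 1 0 0
x = mono₄ 0 0 1 0
y = mono₄ 0 0 0 1

mono₄-1 : mono₄ 0 0 0 0 Q₄.≈ Q₄.1#
mono₄-1 zero    zero    zero    zero    = refl
mono₄-1 zero    zero    zero    (suc _) = refl
mono₄-1 zero    zero    (suc _) _       = refl
mono₄-1 zero    (suc _) _       _       = refl
mono₄-1 (suc _) _       _       _       = refl

T≋ : T ≋ T₅
T≋ = ≋-trans (mono≋ 1 0 0 0 0) (pointwise (Single.single-cong R₄ 1 {mono₄ 0 0 0 0} {Q₄.1#} mono₄-1))

V-single₅ : ∀ n a b → L₅.V n (single 0 a) (single 0 b) ≋ single 0 (L₄.V n a b)
V-single₅ n a b = pointwise (Single.V-single R₄ n a b)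

Vpoly≋ : ∀ n {F G a b} → F ≋ single 0 a → G ≋ single 0 b → Vpoly n F G ≋ single 0 (L₄.V n a b)
Vpoly≋ n p q = ≋-trans (Transport₅.~-V n p q) (V-single₅ n _ _)

inv≋ : ∀ {G g} → G ≋ single 0 g → inv1+t G ≋ inv g
inv≋ {G} {g} p = pointwise λ a b c d e → trans
  (Σ≤-cong a (λ k → at (Transport₅.~-pow k (negS-cong (⊗-cong {F′ = T₅} {G′ = single 0 g} T≋ p))) a b c d e))
  (sym (Coefficient.sum≤-ev R₄ (λ H → H b c d e) (λ _ _ → refl) a _))

module Signed₄ = Signed R₄ (λ n → L₄.V n x y) (λ n → L₄.V n v w)

rhsTerm≋ : ∀ n → rhsTerm n ≋ Signed₄.term n
rhsTerm≋ n = Transport₅.~-term n T≋ (Vpoly≋ n (mono≋ 0 0 0 1 0) (mono≋ 0 0 0 0 1)) (inv≋ (B≋ n))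
  (λ i → ⊗-cong (B≋ i) (inv≋ (B≋ i)))
  where
  B≋ : ∀ i → Vpoly i Vv W ≋ single 0 (L₄.V i v w)
  B≋ i = Vpoly≋ i (mono≋ 0 1 0 0 0) (mono≋ 0 0 1 0 0)

module Weights₄ = L₄.Weights v w x y

rhs-zero : ∀ b c d e → rhs 0 b c d e ≡ 0ℤ
rhs-zero b c d e = trans (at (rhsTerm≋ 0) 0 b c d e) (Signed₄.term-zero b c d e)

rhs-suc : ∀ m b c d e → rhs (suc m) b c d e ≡
  L₄.sumL (allTris m 0) (λ M → if valid [] M then Weights₄.wt M else Q₄.0#) b c d e
rhs-suc m b c d e = begin
  rhs (suc m) b c d e
    ≡⟨ Σ≤-cong (suc m) (λ n → at (rhsTerm≋ n) (suc m) b c d e) ⟩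
  Σ≤ (suc m) (λ n → Signed₄.term n (suc m) b c d e)
    ≡⟨ Coefficient.sum≤-ev R₄ (λ H → H b c d e) (λ _ _ → refl) (suc m) (λ n → Signed₄.term n (suc m)) ⟨
  L₄.sum≤ (suc m) (λ n → Signed₄.term n (suc m)) b c d e
    ≡⟨ Signed₄.sum-terms m b c d e ⟩
  L₄.sum≤ m (λ n → Signed₄.e m n Q₄.* L₄.V n x y) b c d e
    ≡⟨ Signed₄.Z-sum Weights₄.Z (λ _ → Q₄.refl) (λ _ _ → Q₄.refl) m b c d e ⟨
  Weights₄.Z m 0 b c d e
    ≡⟨ Weights₄.sum-valid m [] b c d e ⟨
  L₄.sumL (allTris m 0) (λ M → if valid [] M then Weights₄.wt M else Q₄.0#) b c d e ∎
  where open ≡-Reasoning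

mono₄-* : ∀ i j k l i′ j′ k′ l′ →
  mono₄ i j k l Q₄.* mono₄ i′ j′ k′ l′ Q₄.≈ mono₄ (i + i′) (j + j′) (k + k′) (l + l′)
mono₄-* i j k l i′ j′ k′ l′ b = Q₃.trans {(m₃ Q₄.* m₃′) b} {S₃.single (i + i′) (m₂ Q₃.* m₂′) b}
  (S₃.single-⊛ i i′ m₂ m₂′ b) (S₃.single-cong (i + i′) {m₂ Q₃.* m₂′} eq₂ b)
  where
  module Q₃ = CommutativeRing R₃
  module Q₂ = CommutativeRing R₂
  module Q₁ = CommutativeRing R₁
  module S₃ = Single R₃
  module S₂ = Single R₂
  module S₁ = Single R₁
  module S₀ = Single R₀
  m₀ = S₀.single l 1ℤ
  m₀′ = S₀.single l′ 1ℤ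
  m₁ = S₁.single k m₀
  m₁′ = S₁.single k′ m₀′
  m₂ = S₂.single j m₁
  m₂′ = S₂.single j′ m₁′
  m₃ = S₃.single i m₂
  m₃′ = S₃.single i′ m₂′
  eq₀ : m₀ Q₁.* m₀′ Q₁.≈ S₀.single (l + l′) 1ℤ
  eq₀ = S₀.single-⊛ l l′ 1ℤ 1ℤ
  eq₁ : m₁ Q₂.* m₁′ Q₂.≈ S₁.single (k + k′) (S₀.single (l + l′) 1ℤ)
  eq₁ d = Q₁.trans {(m₁ Q₂.* m₁′) d} {S₁.single (k + k′) (m₀ Q₁.* m₀′) d} (S₁.single-⊛ k k′ m₀ m₀′ d)
    (S₁.single-cong (k + k′) {m₀ Q₁.* m₀′} eq₀ d)
  eq₂ : m₂ Q₃.* m₂′ Q₃.≈ S₂.single (j + j′) (S₁.single (k + k′) (S₀.single (l + l′) 1ℤ))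
  eq₂ d = Q₂.trans {(m₂ Q₃.* m₂′) d} {S₂.single (j + j′) (m₁ Q₂.* m₁′) d} (S₂.single-⊛ j j′ m₁ m₁′ d)
    (S₂.single-cong (j + j′) {m₁ Q₂.* m₁′} eq₁ d)

module Monomials₄ = L₄.Monomials mono₄ mono₄-1 mono₄-*

wt-coeff : ∀ {r n} (M : Tri r n) b c d e → Weights₄.wt M b c d e ≡ (if hasStats b c d e M then 1ℤ else 0ℤ)
wt-coeff M b c d e = trans (Monomials₄.wt-monomial M b c d e) (mono₄-coeff (cellCount false true M)
  (cellCount false false M) (cellCount true true M) (cellCount true false M) b c d e)

-- This completes the algebra; what remains is to match the matrices counted here with isomorphism
-- classes of posets.
length-counted-rhs : ∀ m b c d e →
  + length (filterᵇ (λ M → valid [] M ∧ hasStats b c d e M) (allTris m 0)) ≡ rhs (suc m) b c d e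
length-counted-rhs m b c d e = trans
  (Coefficient.count-ev R₄ (λ H → H b c d e) (λ _ _ → refl) (valid []) (hasStats b c d e) Weights₄.wt
    (λ M → wt-coeff M b c d e) refl (allTris m 0))
  (sym (rhs-suc m b c d e))

-- Boolean tests and lists

<⇒<ᵇ-true : ∀ {m n} → m < n → (m <ᵇ n) ≡ true
<⇒<ᵇ-true m<n = 𝔹ₚ.T-≡ .Equivalence.to (ℕₚ.<⇒<ᵇ m<n)

<ᵇ-true⇒< : ∀ {m n} → (m <ᵇ n) ≡ true → m < n
<ᵇ-true⇒< {m} {n} eq = ℕₚ.<ᵇ⇒< m n (𝔹ₚ.T-≡ .Equivalence.from eq)

≤⇒<ᵇ-false : ∀ {m n} → n ≤ m → (m <ᵇ n) ≡ false
≤⇒<ᵇ-false {m} {n} n≤m with m <ᵇ n in eq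
... | false = refl
... | true  = contradiction (<ᵇ-true⇒< eq) (ℕₚ.≤⇒≯ n≤m)

<ᵇ-false⇒≤ : ∀ {m n} → (m <ᵇ n) ≡ false → n ≤ m
<ᵇ-false⇒≤ {m} {n} eq = ℕₚ.≮⇒≥ λ m<n → contradiction (trans (sym eq) (<⇒<ᵇ-true m<n)) λ ()

true≢false : ∀ {b} → b ≡ true → ¬ b ≡ false
true≢false refl ()

≡⇒≡ᵇ-true : ∀ {m n} → m ≡ n → (m ≡ᵇ n) ≡ true
≡⇒≡ᵇ-true {m} {n} eq = 𝔹ₚ.T-≡ .Equivalence.to (ℕₚ.≡⇒≡ᵇ m n eq)

≡ᵇ-true⇒≡ : ∀ {m n} → (m ≡ᵇ n) ≡ true → m ≡ n
≡ᵇ-true⇒≡ {m} {n} eq = ℕₚ.≡ᵇ⇒≡ m n (𝔹ₚ.T-≡ .Equivalence.from eq)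

≢⇒≡ᵇ-false : ∀ {m n} → ¬ m ≡ n → (m ≡ᵇ n) ≡ false
≢⇒≡ᵇ-false {m} {n} m≢n with m ≡ᵇ n in eq
... | false = refl
... | true  = contradiction (≡ᵇ-true⇒≡ eq) m≢n

any-true : ∀ (p : A → Bool) {x xs} → x ∈ xs → p x ≡ true → any p xs ≡ true
any-true p (here refl) px rewrite px = refl
any-true p {xs = y ∷ _} (there x∈) px with p y
... | true  = refl
... | false = any-true p x∈ px

any-false : ∀ (p : A → Bool) → (∀ x → p x ≡ false) → ∀ xs → any p xs ≡ false
any-false p none []       = refl
any-false p none (x ∷ xs) rewrite none x = any-false p none xs

none-∨ : ∀ (p q : A → Bool) xs →
  not (any (λ x → p x ∨ q x) xs) ≡ not (any p xs) ∧ not (any q xs)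
none-∨ p q []       = refl
none-∨ p q (x ∷ xs) with p x | q x
... | true  | _     = refl
... | false | false = none-∨ p q xs
... | false | true  = sym (𝔹ₚ.∧-zeroʳ (not (any p xs)))

length-filterᵇ-map : ∀ (q : B → Bool) (f : A → B) (p : A → Bool) → (∀ x → p x ≡ q (f x)) → ∀ xs →
  length (filterᵇ p xs) ≡ length (filterᵇ q (map f xs))
length-filterᵇ-map q f p eq []       = refl
length-filterᵇ-map q f p eq (x ∷ xs) rewrite eq x with q (f x)
... | true  = cong suc (length-filterᵇ-map q f p eq xs)
... | false = length-filterᵇ-map q f p eq xs

unique⇒↭ : ∀ {xs ys : List A} → Unique xs → Unique ys →
  (∀ {z} → z ∈ xs → z ∈ ys) → (∀ {z} → z ∈ ys → z ∈ xs) → xs ↭ ys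
unique⇒↭ u u′ f g = ∼bag⇒↭ (unique∧set⇒bag u u′ (mk⇔ f g))

-- Interval orders

-- Row from the bottom and column from the right, both from 0: the interval [i , j] in the usual left-to-right
-- numbering of a matrix of size m + 1 is the cell (m - i , m - j).
Cell : Set
Cell = ℕ × ℕ

is : Bool → Bool → Bool
is τ b = if τ then b else not b

inClass : ℕ → Bool → Bool → Cell → Bool
inClass m isTop isLast (i , j) = is isTop (i ≡ᵇ m) ∧ is isLast (j ≡ᵇ 0)

classCount : ℕ → Bool → Bool → List Cell → ℕ
classCount m isTop isLast cs = length (filterᵇ (inClass m isTop isLast) cs)

-- The common ground of posets and matrices: `row-onto` and `col-onto` exclude zero rows and
-- columns, `cell-inj` bounds the entries by 1. The inequality in `rel` looks reversed because cells
-- are numbered from the bottom right.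
record Rep {k} (P : Poset k) (m : ℕ) : Set where
  open Poset P using (_≺_)
  field
    row col  : Fin k → ℕ
    col≤row  : ∀ x → col x ≤ row x
    row≤     : ∀ x → row x ≤ m
    rel      : ∀ x y → (x ≺ y) ≡ (row y <ᵇ col x)
    row-onto : ∀ i → i ≤ m → ∃ λ x → row x ≡ i
    col-onto : ∀ j → j ≤ m → ∃ λ x → col x ≡ j
    cell-inj : ∀ {x y} → row x ≡ row y → col x ≡ col y → x ≡ y

  cell : Fin k → Cell
  cell x = row x , col x

  cells : List Cell
  cells = map cell (elems P)

  ≺-true : ∀ {x y} → row y < col x → (x ≺ y) ≡ true
  ≺-true p = trans (rel _ _) (<⇒<ᵇ-true p)

  ≺-false : ∀ {x y} → col x ≤ row y → (x ≺ y) ≡ false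
  ≺-false p = trans (rel _ _) (≤⇒<ᵇ-false p)

  ≺-true⁻ : ∀ {x y} → (x ≺ y) ≡ true → row y < col x
  ≺-true⁻ p = <ᵇ-true⇒< (trans (sym (rel _ _)) p)

  ≺-false⁻ : ∀ {x y} → (x ≺ y) ≡ false → col x ≤ row y
  ≺-false⁻ p = <ᵇ-false⇒≤ (trans (sym (rel _ _)) p)

  -- An induced 2 + 2 would close the cycle `row b < col a ≤ row d < col c ≤ row b`.
  intervalOrder : IsIntervalOrder P
  intervalOrder (a , b , c , d , a≺b , c≺d , _ , (_ , a⊀d , _) , (_ , _ , c⊀b) , _) =
    ℕₚ.<-irrefl refl (ℕₚ.<-≤-trans (≺-true⁻ a≺b) (ℕₚ.≤-trans (≺-false⁻ a⊀d)
      (ℕₚ.≤-trans (ℕₚ.<⇒≤ (≺-true⁻ c≺d)) (≺-false⁻ c⊀b))))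

  private
    D-≺ : ∀ {x y} → D P x ≡ D P y → ∀ z → (z ≺ x) ≡ (z ≺ y)
    D-≺ eq z = trans (sym (Vecₚ.lookup∘tabulate _ z)) (trans (cong (λ d → Vec.lookup d z) eq) (Vecₚ.lookup∘tabulate _ z))

    U-≺ : ∀ {x y} → U P x ≡ U P y → ∀ z → (x ≺ z) ≡ (y ≺ z)
    U-≺ eq z = trans (sym (Vecₚ.lookup∘tabulate _ z)) (trans (cong (λ d → Vec.lookup d z) eq) (Vecₚ.lookup∘tabulate _ z))

    -- An element of column `row y` precedes `x` but not `y`; it exists because no column is empty.
    -- Dually, `U-≮` uses that no row is empty.
    D-≮ : ∀ {x y} → D P x ≡ D P y → ¬ row x < row y
    D-≮ {x} {y} eq lt with z , cz ← col-onto (row y) (row≤ y) =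
      true≢false (≺-true (subst (row x <_) (sym cz) lt)) (trans (D-≺ eq z) (≺-false (ℕₚ.≤-reflexive cz)))

    U-≮ : ∀ {x y} → U P x ≡ U P y → ¬ col x < col y
    U-≮ {x} {y} eq lt with z , rz ← row-onto (col x) (ℕₚ.≤-trans (col≤row x) (row≤ x)) =
      true≢false (≺-true (subst (_< col y) (sym rz) lt)) (trans (sym (U-≺ eq z)) (≺-false (ℕₚ.≤-reflexive (sym rz))))

  D-row : ∀ {x y} → D P x ≡ D P y → row x ≡ row y
  D-row eq = ℕₚ.≤-antisym (ℕₚ.≮⇒≥ (D-≮ (sym eq))) (ℕₚ.≮⇒≥ (D-≮ eq))

  U-col : ∀ {x y} → U P x ≡ U P y → col x ≡ col y
  U-col eq = ℕₚ.≤-antisym (ℕₚ.≮⇒≥ (U-≮ (sym eq))) (ℕₚ.≮⇒≥ (U-≮ eq))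

  row-D : ∀ {x y} → row x ≡ row y → D P x ≡ D P y
  row-D eq = Vecₚ.tabulate-cong λ z → trans (rel _ _) (trans (cong (_<ᵇ col z) eq) (sym (rel _ _)))

  isPrimitive : IsPrimitive P
  isPrimitive x y dx ux = cell-inj (D-row dx) (U-col ux)

  -- Down-sets and rows determine each other, and the rows 0 to m are all occupied.
  mag≡ : mag P ≡ suc m
  mag≡ = trans (↭ₚ.↭-length perm) (Listₚ.length-tabulate level)
    where
    level : Fin (suc m) → Vec Bool k
    level i = D P (proj₁ (row-onto (toℕ i) (Finₚ.toℕ≤pred[n] i)))

    level-inj : ∀ {i j} → level i ≡ level j → i ≡ j
    level-inj {i} {j} eq = Finₚ.toℕ-injective (trans (sym (proj₂ (row-onto (toℕ i) (Finₚ.toℕ≤pred[n] i))))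
      (trans (D-row eq) (proj₂ (row-onto (toℕ j) (Finₚ.toℕ≤pred[n] j)))))

    to : ∀ {d} → d ∈ deduplicate (Vecₚ.≡-dec 𝔹ₚ._≟_) (map (D P) (elems P)) → d ∈ tabulate level
    to d∈ with x , _ , refl ← ∈ₚ.∈-map⁻ (D P) (∈ₚ.∈-deduplicate⁻ (Vecₚ.≡-dec 𝔹ₚ._≟_) (map (D P) (elems P)) d∈) =
      subst (_∈ tabulate level) (row-D (trans (proj₂ (row-onto _ _)) (Finₚ.toℕ-fromℕ< (s≤s (row≤ x)))))
        (∈ₚ.∈-tabulate⁺ {f = level} (fromℕ< (s≤s (row≤ x))))

    from : ∀ {d} → d ∈ tabulate level → d ∈ deduplicate (Vecₚ.≡-dec 𝔹ₚ._≟_) (map (D P) (elems P))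
    from d∈ with i , refl ← ∈ₚ.∈-tabulate⁻ {f = level} d∈ =
      ∈ₚ.∈-deduplicate⁺ (Vecₚ.≡-dec 𝔹ₚ._≟_) (∈ₚ.∈-map⁺ (D P) (∈ₚ.∈-allFin _))

    perm : deduplicate (Vecₚ.≡-dec 𝔹ₚ._≟_) (map (D P) (elems P)) ↭ tabulate level
    perm = unique⇒↭ (UniqueDecₚ.deduplicate-! (Vecₚ.≡-dec 𝔹ₚ._≟_) _) (Uniqueₚ.tabulate⁺ level-inj) to from

  -- Column `m` is occupied, and its element precedes everything outside the top row.
  minimal≡ : ∀ x → isMinimal P x ≡ (row x ≡ᵇ m)
  minimal≡ x with row x ℕₚ.≟ m
  ... | yes r≡m = trans (cong not (any-false _ (λ y → ≺-false (subst (col y ≤_) (sym r≡m)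
          (ℕₚ.≤-trans (col≤row y) (row≤ y)))) (elems P))) (sym (≡⇒≡ᵇ-true r≡m))
  ... | no r≢m with y , cy ← col-onto m ℕₚ.≤-refl =
    trans (cong not (any-true (_≺ x) (∈ₚ.∈-allFin y) (≺-true (subst (row x <_) (sym cy) (ℕₚ.≤∧≢⇒< (row≤ x) r≢m)))))
          (sym (≢⇒≡ᵇ-false r≢m))

  maximal≡ : ∀ x → isMaximal P x ≡ (col x ≡ᵇ 0)
  maximal≡ x with col x ℕₚ.≟ 0
  ... | yes c≡0 = trans (cong not (any-false _ (λ y → ≺-false (subst (_≤ row y) (sym c≡0) z≤n)) (elems P)))
                        (sym (≡⇒≡ᵇ-true c≡0))
  ... | no c≢0 with y , ry ← row-onto 0 z≤n =
    trans (cong not (any-true (x ≺_) (∈ₚ.∈-allFin y) (≺-true (subst (_< col x) (sym ry) (ℕₚ.n≢0⇒n>0 c≢0)))))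
          (sym (≢⇒≡ᵇ-false c≢0))

  isolated≡ : ∀ x → isIsolated P x ≡ (col x ≡ᵇ 0) ∧ (row x ≡ᵇ m)
  isolated≡ x = trans (none-∨ (x ≺_) (_≺ x) (elems P)) (cong₂ _∧_ (maximal≡ x) (minimal≡ x))

  max#≡ : max# P ≡ classCount m false true cells
  max#≡ = length-filterᵇ-map _ cell _ (λ x → trans (cong₂ (λ p q → p ∧ not q) (maximal≡ x) (isolated≡ x))
    (lemma (row x ≡ᵇ m) (col x ≡ᵇ 0))) (elems P)
    where
    lemma : ∀ r c → c ∧ not (c ∧ r) ≡ not r ∧ c
    lemma true  true  = refl
    lemma true  false = refl
    lemma false true  = refl
    lemma false false = refl

  int#≡ : int# P ≡ classCount m false false cells
  int#≡ = length-filterᵇ-map _ cell _ (λ x → cong₂ (λ p q → not p ∧ not q) (minimal≡ x) (maximal≡ x)) (elems P)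

  iso#≡ : iso# P ≡ classCount m true true cells
  iso#≡ = length-filterᵇ-map _ cell _ (λ x → trans (isolated≡ x) (𝔹ₚ.∧-comm (col x ≡ᵇ 0) (row x ≡ᵇ m))) (elems P)

  min#≡ : min# P ≡ classCount m true false cells
  min#≡ = length-filterᵇ-map _ cell _ (λ x → trans (cong₂ (λ p q → p ∧ not q) (minimal≡ x) (isolated≡ x))
    (lemma (row x ≡ᵇ m) (col x ≡ᵇ 0))) (elems P)
    where
    lemma : ∀ r c → r ∧ not (c ∧ r) ≡ r ∧ not c
    lemma true  true  = refl
    lemma true  false = refl
    lemma false true  = refl
    lemma false false = refl

-- Rigidity: the order determines the cells

module _ {k l m} {P : Poset k} {Q : Poset l} (ρ : Rep P m) (σ : Rep Q m)
  (f : Fin k → Fin l) (f-≺ : ∀ x y → Poset._≺_ P x y ≡ Poset._≺_ Q (f x) (f y)) where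
  private
    module P = Rep ρ
    module Q = Rep σ

  -- An element y of column suc n precedes exactly the elements of rows ≤ n, which separates x from row n.
  row-monotone : ∀ n x → P.row x ≡ n → n ≤ Q.row (f x)
  row-monotone zero    x _  = z≤n
  row-monotone (suc n) x rx
    with y , cy ← P.col-onto (suc n) (subst (_≤ m) rx (P.row≤ x))
       | z , rz ← P.row-onto n (ℕₚ.≤-trans (ℕₚ.n≤1+n n) (subst (_≤ m) rx (P.row≤ x))) =
    ℕₚ.≤-trans (s≤s (row-monotone n z rz)) (ℕₚ.<-≤-trans
      (Q.≺-true⁻ (trans (sym (f-≺ y z)) (P.≺-true (ℕₚ.≤-reflexive (trans (cong suc rz) (sym cy))))))
      (Q.≺-false⁻ (trans (sym (f-≺ y x)) (P.≺-false (ℕₚ.≤-reflexive (trans cy (sym rx)))))))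

  -- If the columns differed, take an element in the row numbered by the smaller one: since rows are
  -- kept, it would lie above `x` without its image lying above `f x`, or conversely.
  col-preserved : (∀ x → Q.row (f x) ≡ P.row x) → ∀ x → Q.col (f x) ≡ P.col x
  col-preserved row≡ x with ℕₚ.<-cmp (Q.col (f x)) (P.col x)
  ... | tri≈ _ eq _ = eq
  ... | tri< lt _ _ with z , rz ← P.row-onto (Q.col (f x)) (ℕₚ.≤-trans (Q.col≤row (f x)) (Q.row≤ (f x))) =
    contradiction (trans (f-≺ x z) (Q.≺-false (ℕₚ.≤-reflexive (trans (sym rz) (sym (row≡ z))))))
      (true≢false (P.≺-true (subst (_< P.col x) (sym rz) lt)))
  ... | tri> _ _ gt with z , rz ← P.row-onto (P.col x) (ℕₚ.≤-trans (P.col≤row x) (P.row≤ x)) =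
    contradiction (trans (sym (f-≺ x z)) (P.≺-false (ℕₚ.≤-reflexive (sym rz))))
      (true≢false (Q.≺-true (subst (_< Q.col (f x)) (trans (sym rz) (sym (row≡ z))) gt)))

module _ {k l m} {P : Poset k} {Q : Poset l} (ρ : Rep P m) (σ : Rep Q m) (iso : (k , P) ≅ (l , Q)) where
  private
    module P = Rep ρ
    module Q = Rep σ
    to   = Inverse.to (proj₁ iso)
    from = Inverse.from (proj₁ iso)

  row-iso : ∀ x → Q.row (to x) ≡ P.row x
  row-iso x = ℕₚ.≤-antisym
    (subst (λ z → Q.row (to x) ≤ P.row z) (Inverse.strictlyInverseʳ (proj₁ iso) x)
      (row-monotone σ ρ from from-≺ _ (to x) refl))
    (row-monotone ρ σ to (proj₂ iso) _ x refl)
    where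
    from-≺ : ∀ x y → Poset._≺_ Q x y ≡ Poset._≺_ P (from x) (from y)
    from-≺ x y = trans (sym (cong₂ (Poset._≺_ Q) (Inverse.strictlyInverseˡ (proj₁ iso) x)
                                                (Inverse.strictlyInverseˡ (proj₁ iso) y)))
                       (sym (proj₂ iso (from x) (from y)))

  -- Hence the set of cells is an invariant of the isomorphism class, and distinct matrices give
  -- non-isomorphic posets.
  cell-iso : ∀ x → Q.cell (to x) ≡ P.cell x
  cell-iso x = cong₂ _,_ (row-iso x) (col-preserved ρ σ to (proj₂ iso) row-iso x)

-- Counting and the pigeonhole principle

module _ {P Q : A → Set} (P? : Decidable P) (Q? : Decidable Q) where
  count-≤ : ∀ xs → (∀ {x} → x ∈ xs → P x → Q x) → length (filter P? xs) ≤ length (filter Q? xs)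
  count-≤ []       P⇒Q = z≤n
  count-≤ (x ∷ xs) P⇒Q with P? x | Q? x
  ... | yes _  | yes _  = s≤s (count-≤ xs (P⇒Q ∘ there))
  ... | yes px | no ¬qx = contradiction (P⇒Q (here refl) px) ¬qx
  ... | no _   | yes _  = ℕₚ.m≤n⇒m≤1+n (count-≤ xs (P⇒Q ∘ there))
  ... | no _   | no _   = count-≤ xs (P⇒Q ∘ there)

  count-< : ∀ xs → (∀ {x} → x ∈ xs → P x → Q x) → ∀ {y} → y ∈ xs → Q y → ¬ P y →
    length (filter P? xs) < length (filter Q? xs)
  count-< (x ∷ xs) P⇒Q (here refl) qy ¬py with P? x | Q? x
  ... | yes px | _      = contradiction px ¬py
  ... | no _   | no ¬qx = contradiction qy ¬qx
  ... | no _   | yes _  = s≤s (count-≤ xs (P⇒Q ∘ there))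
  count-< (x ∷ xs) P⇒Q (there y∈) qy ¬py with P? x | Q? x
  ... | yes _  | yes _  = s≤s (count-< xs (P⇒Q ∘ there) y∈ qy ¬py)
  ... | yes px | no ¬qx = contradiction (P⇒Q (here refl) px) ¬qx
  ... | no _   | yes _  = ℕₚ.m≤n⇒m≤1+n (count-< xs (P⇒Q ∘ there) y∈ qy ¬py)
  ... | no _   | no _   = count-< xs (P⇒Q ∘ there) y∈ qy ¬py

lookup-injective : ∀ {xs : List A} → Unique xs → ∀ {i j} → lookup xs i ≡ lookup xs j → i ≡ j
lookup-injective (_ ∷ _)  {Fin.zero}  {Fin.zero}  _  = refl
lookup-injective (p ∷ _)  {Fin.zero}  {Fin.suc j} eq = contradiction eq (All.lookup p (∈ₚ.∈-lookup j))
lookup-injective (p ∷ _)  {Fin.suc i} {Fin.zero}  eq = contradiction (sym eq) (All.lookup p (∈ₚ.∈-lookup i))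
lookup-injective (_ ∷ u)  {Fin.suc i} {Fin.suc j} eq = cong Fin.suc (lookup-injective u eq)

-- A missed value could be punched out, which would embed `Fin (suc n)` into `Fin n`.
injective⇒surjective : ∀ {n} (f : Fin n → Fin n) → (∀ {i j} → f i ≡ f j → i ≡ j) → ∀ j → ∃ λ i → f i ≡ j
injective⇒surjective {suc n} f inj j with Finₚ.any? (λ i → f i Finₚ.≟ j)
... | yes hit = hit
... | no miss = contradiction
  (Finₚ.injective⇒≤ {f = λ i → punchOut (avoid i)} (λ {x} {y} eq → inj (Finₚ.punchOut-injective (avoid x) (avoid y) eq)))
  (ℕₚ.<⇒≱ ℕₚ.≤-refl)
  where
  avoid : ∀ i → j ≢ f i
  avoid i eq = miss (i , sym eq)

-- The canonical representation of a primitive interval order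

module Canonical {k m} (P : Poset k) (io : IsIntervalOrder P) (prim : IsPrimitive P)
  (Ds : List (Vec Bool k)) (Ds-unique : Unique Ds) (length-Ds : length Ds ≡ suc m)
  (D∈Ds : ∀ x → D P x ∈ Ds) (Ds-D : ∀ {d} → d ∈ Ds → ∃ λ x → d ≡ D P x) where
  open Poset P using (_≺_; irrefl) renaming (trans to ≺-trans)

  -- For members of the chain of down-sets this is strict inclusion of the second in the first; the
  -- explicit witness `a` is what the arguments below work with.
  Exceeds : Vec Bool k → Vec Bool k → Set
  Exceeds d d′ = ∃ λ a → Vec.lookup d a ≡ true × Vec.lookup d′ a ≡ false

  exceeds? : ∀ d d′ → Dec (Exceeds d d′)
  exceeds? d d′ = Finₚ.any? λ a → (Vec.lookup d a 𝔹ₚ.≟ true) ×-dec (Vec.lookup d′ a 𝔹ₚ.≟ false)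

  -- The levels are the strict down-sets; x spans the levels from D x up to the last one not containing x.
  row col : Fin k → ℕ
  row x = length (filter (λ d → exceeds? d (D P x)) Ds)
  col x = length (filter (λ d → Vec.lookup d x 𝔹ₚ.≟ true) Ds)

  private
    lookup-D : ∀ x a → Vec.lookup (D P x) a ≡ (a ≺ x)
    lookup-D x = Vecₚ.lookup∘tabulate _

    exceeds-irrefl : ∀ d → ¬ Exceeds d d
    exceeds-irrefl d (a , p , q) = true≢false p q

    exceeds : ∀ {a x y} → (a ≺ x) ≡ true → (a ≺ y) ≡ false → Exceeds (D P x) (D P y)
    exceeds {a} {x} {y} p q = a , trans (lookup-D x a) p , trans (lookup-D y a) q

  -- Otherwise a ≺ x and c ≺ y would span an induced 2 + 2.
  chain : ∀ {a x c y} → (a ≺ x) ≡ true → (a ≺ y) ≡ false → (c ≺ y) ≡ true → (c ≺ x) ≡ true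
  chain {a} {x} {c} {y} a≺x a⊀y c≺y with c ≺ x in c⊀x
  ... | true  = refl
  ... | false = contradiction
    (a , x , c , y , a≺x , c≺y
      , ((λ { refl → true≢false a≺x c⊀x }) , not-true (λ p → true≢false (≺-trans a c y p c≺y) a⊀y)
                                           , not-true (λ p → true≢false (≺-trans c a x p a≺x) c⊀x))
      , ((λ { refl → true≢false (≺-trans c y x c≺y a≺x) c⊀x }) , a⊀y
          , not-true (λ p → true≢false (≺-trans c a x (≺-trans c y a c≺y p) a≺x) c⊀x))
      , ((λ { refl → true≢false (≺-trans a x y a≺x c≺y) a⊀y })
          , not-true (λ p → true≢false (≺-trans a x y a≺x (≺-trans x c y p c≺y)) a⊀y) , c⊀x)
      , ((λ { refl → true≢false a≺x a⊀y }) , not-true (λ p → true≢false (≺-trans a x y a≺x p) a⊀y)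
                                           , not-true (λ p → true≢false (≺-trans c y x c≺y p) c⊀x)))
    io
    where
    not-true : ∀ {b} → ¬ b ≡ true → b ≡ false
    not-true = 𝔹ₚ.¬-not

  -- By `chain` the single witness `a` lies in every down-set exceeding `D x`, so all of these
  -- exceed `D y`. Strictness comes from `D x`, which exceeds `D y` but not itself.
  row-< : ∀ {a x y} → (a ≺ x) ≡ true → (a ≺ y) ≡ false → row x < row y
  row-< {a} {x} {y} a≺x a⊀y = count-< _ _ Ds step (D∈Ds x) (exceeds a≺x a⊀y) (exceeds-irrefl (D P x))
    where
    step : ∀ {d} → d ∈ Ds → Exceeds d (D P x) → Exceeds d (D P y)
    step d∈ (b , b∈d , b∉x) with z , refl ← Ds-D d∈ =
      exceeds (chain (trans (sym (lookup-D z b)) b∈d) (trans (sym (lookup-D x b)) b∉x) a≺x) a⊀y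

  -- By `chain` every down-set exceeding `D y` contains `x`; so does `D y`, which does not exceed
  -- itself.
  ≺⇒< : ∀ {x y} → (x ≺ y) ≡ true → row y < col x
  ≺⇒< {x} {y} x≺y = count-< _ _ Ds step (D∈Ds y) (trans (lookup-D y x) x≺y) (exceeds-irrefl (D P y))
    where
    step : ∀ {d} → d ∈ Ds → Exceeds d (D P y) → Vec.lookup d x ≡ true
    step d∈ (b , b∈d , b∉y) with z , refl ← Ds-D d∈ =
      trans (lookup-D z x) (chain (trans (sym (lookup-D z b)) b∈d) (trans (sym (lookup-D y b)) b∉y) x≺y)

  -- The element `x` itself witnesses that a down-set containing it exceeds `D y`.
  ⊀⇒≤ : ∀ {x y} → (x ≺ y) ≡ false → col x ≤ row y
  ⊀⇒≤ {x} {y} x⊀y = count-≤ _ _ Ds λ _ x∈d → x , x∈d , trans (lookup-D y x) x⊀y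

  row-bound : ∀ x → row x < length Ds
  row-bound x = (Listₚ.filter-notAll _ Ds (lose (D∈Ds x) (exceeds-irrefl (D P x))))

  rel : ∀ x y → (x ≺ y) ≡ (row y <ᵇ col x)
  rel x y with x ≺ y in eq
  ... | true  = sym (<⇒<ᵇ-true (≺⇒< eq))
  ... | false = sym (≤⇒<ᵇ-false (⊀⇒≤ eq))

  row-D : ∀ {x y} → row x ≡ row y → D P x ≡ D P y
  row-D {x} {y} eq = Vecₚ.tabulate-cong same
    where
    same : ∀ a → (a ≺ x) ≡ (a ≺ y)
    same a with a ≺ x in p | a ≺ y in q
    ... | true  | true  = refl
    ... | false | false = refl
    ... | true  | false = contradiction eq (ℕₚ.<⇒≢ (row-< p q))
    ... | false | true  = contradiction (sym eq) (ℕₚ.<⇒≢ (row-< q p))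

  -- Distinct down-sets have distinct ranks, all below the number of down-sets, so every rank is
  -- attained.
  row-onto : ∀ i → i ≤ m → ∃ λ x → row x ≡ i
  row-onto i i≤m =
    let j , eq = injective⇒surjective rank rank-inj (fromℕ< i<) in
    elem j , trans (sym (Finₚ.toℕ-fromℕ< (row-bound (elem j)))) (trans (cong toℕ eq) (Finₚ.toℕ-fromℕ< i<))
    where
    i< : i < length Ds
    i< = subst (i <_) (sym length-Ds) (s≤s i≤m)

    elem : Fin (length Ds) → Fin k
    elem j = proj₁ (Ds-D (∈ₚ.∈-lookup {xs = Ds} j))

    rank : Fin (length Ds) → Fin (length Ds)
    rank j = fromℕ< (row-bound (elem j))

    rank-inj : ∀ {i j} → rank i ≡ rank j → i ≡ j
    rank-inj {i} {j} eq = lookup-injective Ds-unique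
      (trans (proj₂ (Ds-D (∈ₚ.∈-lookup {xs = Ds} i)))
        (trans (row-D (Finₚ.fromℕ<-injective _ _ (row-bound (elem i)) (row-bound (elem j)) eq))
          (sym (proj₂ (Ds-D (∈ₚ.∈-lookup {xs = Ds} j))))))

  col≤row : ∀ x → col x ≤ row x
  col≤row x = ⊀⇒≤ (irrefl x)

  -- An element in the down-set of row `j` but not in that of row `suc j` has column `suc j`.
  -- Without such an element the first down-set would lie inside the second, against the order of
  -- the rows.
  col-onto : ∀ j → j ≤ m → ∃ λ x → col x ≡ j
  col-onto zero    _   with x , rx ← row-onto 0 z≤n = x , ℕₚ.n≤0⇒n≡0 (subst (col x ≤_) rx (col≤row x))
  col-onto (suc j) j<m with y , ry ← row-onto (suc j) j<m | z , rz ← row-onto j (ℕₚ.<⇒≤ j<m)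
    with exceeds? (D P z) (D P y)
  ... | yes (a , a∈z , a∉y) = a , ℕₚ.≤-antisym
    (subst (col a ≤_) ry (⊀⇒≤ (trans (sym (lookup-D y a)) a∉y)))
    (subst (λ i → suc i ≤ col a) rz (≺⇒< (trans (sym (lookup-D z a)) a∈z)))
  ... | no ¬exc = contradiction (subst (_≤ row z) ry (count-≤ _ _ Ds step)) (ℕₚ.<⇒≱ (s≤s (ℕₚ.≤-reflexive rz)))
    where
    step : ∀ {d} → d ∈ Ds → Exceeds d (D P y) → Exceeds d (D P z)
    step _ (b , b∈d , b∉y) = b , b∈d , 𝔹ₚ.¬-not λ b∈z → ¬exc (b , b∈z , b∉y)

  rep : Rep P m
  rep = record
    { row = row
    ; col = col
    ; col≤row = col≤row
    ; row≤ = λ x → ℕₚ.≤-pred (subst (row x <_) length-Ds (row-bound x))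
    ; rel = rel
    ; row-onto = row-onto
    ; col-onto = col-onto
    ; cell-inj = λ {x} {y} rx cx → prim x y (row-D rx) (Vecₚ.tabulate-cong λ z →
        trans (rel x z) (trans (cong (row z <ᵇ_) cx) (sym (rel y z))))
    }

primitive⇒Rep : ∀ {k m} (P : Poset k) → IsIntervalOrder P → IsPrimitive P → mag P ≡ suc m → Rep P m
primitive⇒Rep P io prim mag≡ = Canonical.rep P io prim
  (deduplicate _≟_ (map (D P) (elems P))) (UniqueDecₚ.deduplicate-! _≟_ (map (D P) (elems P))) mag≡
  (λ x → ∈ₚ.∈-deduplicate⁺ _≟_ (∈ₚ.∈-map⁺ (D P) (∈ₚ.∈-allFin x)))
  (λ d∈ → let x , _ , eq = ∈ₚ.∈-map⁻ (D P) (∈ₚ.∈-deduplicate⁻ _≟_ (map (D P) (elems P)) d∈) in x , eq)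
  where _≟_ = Vecₚ.≡-dec 𝔹ₚ._≟_

-- Positions of the nonzero entries in a row

∧-true : ∀ {p q} → p ∧ q ≡ true → p ≡ true × q ≡ true
∧-true {true} {true} _ = refl , refl

-- Counting from the right gives a column the same number in all rows, despite their different
-- lengths; 0 is left to the last column.
ones : Vec Bool n → List ℕ
ones []                    = []
ones {suc n} (true ∷ v)  = suc n ∷ ones v
ones         (false ∷ v) = ones v

ones-≥1 : ∀ (v : Vec Bool n) {j} → j ∈ ones v → 1 ≤ j
ones-≥1 (true ∷ v)  (here refl) = s≤s z≤n
ones-≥1 (true ∷ v)  (there j∈)  = ones-≥1 v j∈
ones-≥1 (false ∷ v) j∈          = ones-≥1 v j∈

ones-≤ : ∀ (v : Vec Bool n) {j} → j ∈ ones v → j ≤ n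
ones-≤ (true ∷ v)  (here refl) = ℕₚ.≤-refl
ones-≤ (true ∷ v)  (there j∈)  = ℕₚ.m≤n⇒m≤1+n (ones-≤ v j∈)
ones-≤ (false ∷ v) j∈          = ℕₚ.m≤n⇒m≤1+n (ones-≤ v j∈)

ones-unique : ∀ (v : Vec Bool n) → Unique (ones v)
ones-unique []          = []
ones-unique (true ∷ v)  = All.tabulate (λ j∈ eq → ℕₚ.1+n≰n (subst (_≤ _) (sym eq) (ones-≤ v j∈))) ∷ ones-unique v
ones-unique (false ∷ v) = ones-unique v

ones-∷ : ∀ b (v : Vec Bool n) {j} → j ∈ ones v → j ∈ ones (b ∷ v)
ones-∷ true  v = there
ones-∷ false v = id

ones-∷⁻ : ∀ b (v : Vec Bool n) {j} → j ≤ n → j ∈ ones (b ∷ v) → j ∈ ones v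
ones-∷⁻ true  v j≤n (here refl) = contradiction j≤n ℕₚ.1+n≰n
ones-∷⁻ true  v j≤n (there j∈)  = j∈
ones-∷⁻ false v j≤n j∈          = j∈

ones-∷-top : ∀ b (v : Vec Bool n) → suc n ∈ ones (b ∷ v) → b ≡ true
ones-∷-top true  v _  = refl
ones-∷-top false v j∈ = contradiction (ones-≤ v j∈) ℕₚ.1+n≰n

ones-injective : ∀ (u v : Vec Bool n) → (∀ {j} → j ∈ ones u → j ∈ ones v) →
  (∀ {j} → j ∈ ones v → j ∈ ones u) → u ≡ v
ones-injective []      []      f g = refl
ones-injective {suc n} (b ∷ u) (b′ ∷ v) f g = cong₂ _∷_ (heads b b′ f g)
  (ones-injective u v (λ j∈ → ones-∷⁻ b′ v (ones-≤ u j∈) (f (ones-∷ b u j∈)))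
                      (λ j∈ → ones-∷⁻ b u (ones-≤ v j∈) (g (ones-∷ b′ v j∈))))
  where
  heads : ∀ b b′ → (∀ {j} → j ∈ ones (b ∷ u) → j ∈ ones (b′ ∷ v)) →
    (∀ {j} → j ∈ ones (b′ ∷ v) → j ∈ ones (b ∷ u)) → b ≡ b′
  heads true  b′    f g = sym (ones-∷-top b′ v (f (here refl)))
  heads false true  f g = ones-∷-top false u (g (here refl))
  heads false false f g = refl

ones-∨ˡ : ∀ (u v : Vec Bool n) {j} → j ∈ ones u → j ∈ ones (u ∨ᵥ v)
ones-∨ˡ (true ∷ u)  (b ∷ v)     (here refl) = here refl
ones-∨ˡ (true ∷ u)  (b ∷ v)     (there j∈)  = there (ones-∨ˡ u v j∈)
ones-∨ˡ (false ∷ u) (b ∷ v)     j∈          = ones-∷ b _ (ones-∨ˡ u v j∈)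

ones-∨ʳ : ∀ (u v : Vec Bool n) {j} → j ∈ ones v → j ∈ ones (u ∨ᵥ v)
ones-∨ʳ (true ∷ u)  (true ∷ v)  (here refl) = here refl
ones-∨ʳ (true ∷ u)  (true ∷ v)  (there j∈)  = there (ones-∨ʳ u v j∈)
ones-∨ʳ (true ∷ u)  (false ∷ v) j∈          = there (ones-∨ʳ u v j∈)
ones-∨ʳ (false ∷ u) (true ∷ v)  (here refl) = here refl
ones-∨ʳ (false ∷ u) (true ∷ v)  (there j∈)  = there (ones-∨ʳ u v j∈)
ones-∨ʳ (false ∷ u) (false ∷ v) j∈          = ones-∨ʳ u v j∈

ones-∨⁻ : ∀ (u v : Vec Bool n) {j} → j ∈ ones (u ∨ᵥ v) → j ∈ ones u ⊎ j ∈ ones v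
ones-∨⁻ []          []          ()
ones-∨⁻ (true ∷ u)  (b ∷ v)     (here refl) = inj₁ (here refl)
ones-∨⁻ (true ∷ u)  (b ∷ v)     (there j∈)  = [ inj₁ ∘ there , inj₂ ∘ ones-∷ b v ]′ (ones-∨⁻ u v j∈)
ones-∨⁻ (false ∷ u) (true ∷ v)  (here refl) = inj₂ (here refl)
ones-∨⁻ (false ∷ u) (true ∷ v)  (there j∈)  = [ inj₁ , inj₂ ∘ there ]′ (ones-∨⁻ u v j∈)
ones-∨⁻ (false ∷ u) (false ∷ v) j∈          = ones-∨⁻ u v j∈

allTrue⇒ones : ∀ (v : Vec Bool n) → allTrue v ≡ true → ∀ {j} → 1 ≤ j → j ≤ n → j ∈ ones v
allTrue⇒ones []         _   (s≤s _) ()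
allTrue⇒ones {suc n} (true ∷ v) all {j} 1≤j j≤ with j ℕₚ.≟ suc n
... | yes refl = here refl
... | no j≢    = there (allTrue⇒ones v all 1≤j (ℕₚ.≤-pred (ℕₚ.≤∧≢⇒< j≤ j≢)))

ones⇒allTrue : ∀ (v : Vec Bool n) → (∀ {j} → 1 ≤ j → j ≤ n → j ∈ ones v) → allTrue v ≡ true
ones⇒allTrue []      all = refl
ones⇒allTrue (b ∷ v) all = cong₂ _∧_ (ones-∷-top b v (all (s≤s z≤n) ℕₚ.≤-refl))
  (ones⇒allTrue v λ 1≤j j≤n → ones-∷⁻ b v j≤n (all 1≤j (ℕₚ.m≤n⇒m≤1+n j≤n)))

anyTrue⇒ones : ∀ (v : Vec Bool n) → anyTrue v ≡ true → ∃ λ j → j ∈ ones v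
anyTrue⇒ones (true ∷ v)  _  = _ , here refl
anyTrue⇒ones (false ∷ v) an = anyTrue⇒ones v an

ones⇒anyTrue : ∀ (v : Vec Bool n) {j} → j ∈ ones v → anyTrue v ≡ true
ones⇒anyTrue (true ∷ v)  _  = refl
ones⇒anyTrue (false ∷ v) j∈ = ones⇒anyTrue v j∈

length-ones : ∀ (v : Vec Bool n) → length (ones v) ≡ countTrue v
length-ones []          = refl
length-ones (true ∷ v)  = cong suc (length-ones v)
length-ones (false ∷ v) = length-ones v

rowOnes : Row n → List ℕ
rowOnes (true , ρ)  = 0 ∷ ones ρ
rowOnes (false , ρ) = ones ρ

rowOnes-ones : ∀ l (ρ : Vec Bool n) {j} → j ∈ ones ρ → j ∈ rowOnes (l , ρ)
rowOnes-ones true  ρ = there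
rowOnes-ones false ρ = id

rowOnes-ones⁻ : ∀ l (ρ : Vec Bool n) {j} → 1 ≤ j → j ∈ rowOnes (l , ρ) → j ∈ ones ρ
rowOnes-ones⁻ true  ρ () (here refl)
rowOnes-ones⁻ true  ρ _  (there j∈) = j∈
rowOnes-ones⁻ false ρ _  j∈         = j∈

rowOnes-0 : ∀ l (ρ : Vec Bool n) → 0 ∈ rowOnes (l , ρ) → l ≡ true
rowOnes-0 true  ρ _  = refl
rowOnes-0 false ρ 0∈ with () ← ones-≥1 ρ 0∈

rowOnes-≤ : ∀ (ρ : Row n) {j} → j ∈ rowOnes ρ → j ≤ n
rowOnes-≤ (true , ρ)  (here refl) = z≤n
rowOnes-≤ (true , ρ)  (there j∈)  = ones-≤ ρ j∈
rowOnes-≤ (false , ρ) j∈          = ones-≤ ρ j∈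

rowOnes-unique : ∀ (ρ : Row n) → Unique (rowOnes ρ)
rowOnes-unique (true , ρ)  = All.tabulate (λ { j∈ refl → contradiction (ones-≥1 ρ j∈) λ () }) ∷ ones-unique ρ
rowOnes-unique (false , ρ) = ones-unique ρ

rowOnes-injective : ∀ (ρ σ : Row n) → (∀ {j} → j ∈ rowOnes ρ → j ∈ rowOnes σ) →
  (∀ {j} → j ∈ rowOnes σ → j ∈ rowOnes ρ) → ρ ≡ σ
rowOnes-injective (l , ρ) (l′ , σ) f g = cong₂ _,_ (lasts l l′ f g) (ones-injective ρ σ
  (λ j∈ → rowOnes-ones⁻ l′ σ (ones-≥1 ρ j∈) (f (rowOnes-ones l ρ j∈)))
  (λ j∈ → rowOnes-ones⁻ l ρ (ones-≥1 σ j∈) (g (rowOnes-ones l′ σ j∈))))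
  where
  lasts : ∀ l l′ → (∀ {j} → j ∈ rowOnes (l , ρ) → j ∈ rowOnes (l′ , σ)) →
    (∀ {j} → j ∈ rowOnes (l′ , σ) → j ∈ rowOnes (l , ρ)) → l ≡ l′
  lasts true  l′    f g = sym (rowOnes-0 l′ σ (f (here refl)))
  lasts false true  f g = rowOnes-0 false ρ (g (here refl))
  lasts false false f g = refl

nonempty⇒rowOnes : ∀ (ρ : Row n) → nonempty ρ ≡ true → ∃ λ j → j ∈ rowOnes ρ
nonempty⇒rowOnes (true , ρ)  _  = 0 , here refl
nonempty⇒rowOnes (false , ρ) ne = anyTrue⇒ones ρ ne

rowOnes⇒nonempty : ∀ (ρ : Row n) {j} → j ∈ rowOnes ρ → nonempty ρ ≡ true
rowOnes⇒nonempty (true , ρ)  _  = refl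
rowOnes⇒nonempty (false , ρ) j∈ = ones⇒anyTrue ρ j∈

-- Cells of a triangular matrix

rowCells : ℕ → Row n → List Cell
rowCells i ρ = map (i ,_) (rowOnes ρ)

triCells : Tri r n → List Cell
triCells {n = n} (top ρ) = rowCells n ρ
triCells {n = n} (ρ ▹ M) = rowCells n ρ ++ triCells M

rowCells⁺ : ∀ i (ρ : Row n) {j} → j ∈ rowOnes ρ → (i , j) ∈ rowCells i ρ
rowCells⁺ i ρ = ∈ₚ.∈-map⁺ (i ,_)

rowCells⁻ : ∀ i′ (ρ : Row n) {i j} → (i , j) ∈ rowCells i′ ρ → i ≡ i′ × j ∈ rowOnes ρ
rowCells⁻ i′ ρ p with _ , j∈ , refl ← ∈ₚ.∈-map⁻ (i′ ,_) p = refl , j∈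

record Bounded (r n i j : ℕ) : Set where
  constructor bounded
  field
    lower : n ≤ i
    upper : i ≤ r + n
    below : j ≤ i
open Bounded public

triCells-bounded : ∀ (M : Tri r n) {i j} → (i , j) ∈ triCells M → Bounded r n i j
triCells-bounded {n = n} (top ρ) p with refl , j∈ ← rowCells⁻ n ρ p =
  bounded ℕₚ.≤-refl ℕₚ.≤-refl (rowOnes-≤ ρ j∈)
triCells-bounded {suc r} {n} (ρ ▹ M) p with ∈ₚ.∈-++⁻ (rowCells n ρ) p
... | inj₁ q with refl , j∈ ← rowCells⁻ n ρ q = bounded ℕₚ.≤-refl (ℕₚ.m≤n+m n (suc r)) (rowOnes-≤ ρ j∈)
... | inj₂ q with bounded lo up be ← triCells-bounded M q =
  bounded (ℕₚ.<⇒≤ lo) (ℕₚ.≤-trans up (ℕₚ.≤-reflexive (ℕₚ.+-suc r n))) be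

rowCells-unique : ∀ i (ρ : Row n) → Unique (rowCells i ρ)
rowCells-unique i ρ = Uniqueₚ.map⁺ (cong proj₂) (rowOnes-unique ρ)

triCells-unique : ∀ (M : Tri r n) → Unique (triCells M)
triCells-unique {n = n} (top ρ) = rowCells-unique n ρ
triCells-unique {n = n} (ρ ▹ M) = Uniqueₚ.++⁺ (rowCells-unique n ρ) (triCells-unique M)
  λ { {i , j} (p , q) → ℕₚ.1+n≰n (subst (suc n ≤_) (proj₁ (rowCells⁻ n ρ p)) (lower (triCells-bounded M q))) }

module _ (ρ : Row n) (M : Tri r (suc n)) where
  bottom⁺ : ∀ {j} → j ∈ rowOnes ρ → (n , j) ∈ triCells (ρ ▹ M)
  bottom⁺ j∈ = ∈ₚ.∈-++⁺ˡ (rowCells⁺ n ρ j∈)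

  bottom⁻ : ∀ {j} → (n , j) ∈ triCells (ρ ▹ M) → j ∈ rowOnes ρ
  bottom⁻ p with ∈ₚ.∈-++⁻ (rowCells n ρ) p
  ... | inj₁ q = proj₂ (rowCells⁻ n ρ q)
  ... | inj₂ q = contradiction (lower (triCells-bounded M q)) ℕₚ.1+n≰n

  rest⁺ : ∀ {z} → z ∈ triCells M → z ∈ triCells (ρ ▹ M)
  rest⁺ = ∈ₚ.∈-++⁺ʳ (rowCells n ρ)

  rest⁻ : ∀ {i j} → suc n ≤ i → (i , j) ∈ triCells (ρ ▹ M) → (i , j) ∈ triCells M
  rest⁻ n<i p with ∈ₚ.∈-++⁻ (rowCells n ρ) p
  ... | inj₁ q = contradiction (subst (suc n ≤_) (proj₁ (rowCells⁻ n ρ q)) n<i) ℕₚ.1+n≰n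
  ... | inj₂ q = q

triCells-injective : ∀ (M N : Tri r n) → (∀ {z} → z ∈ triCells M → z ∈ triCells N) →
  (∀ {z} → z ∈ triCells N → z ∈ triCells M) → M ≡ N
triCells-injective {n = n} (top ρ) (top σ) f g = cong top (rowOnes-injective ρ σ
  (λ j∈ → proj₂ (rowCells⁻ n σ (f (rowCells⁺ n ρ j∈))))
  (λ j∈ → proj₂ (rowCells⁻ n ρ (g (rowCells⁺ n σ j∈)))))
triCells-injective (ρ ▹ M) (σ ▹ N) f g = cong₂ _▹_
  (rowOnes-injective ρ σ (λ j∈ → bottom⁻ σ N (f (bottom⁺ ρ M j∈))) (λ j∈ → bottom⁻ ρ M (g (bottom⁺ σ N j∈))))
  (triCells-injective M N (λ z∈ → rest⁻ σ N (lower (triCells-bounded M z∈)) (f (rest⁺ ρ M z∈)))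
                          (λ z∈ → rest⁻ ρ M (lower (triCells-bounded N z∈)) (g (rest⁺ σ N z∈))))

valid⇒row : ∀ fl (M : Tri r n) → valid fl M ≡ true → ∀ {i} → n ≤ i → i ≤ r + n → ∃ λ j → (i , j) ∈ triCells M
valid⇒row {n = n} fl (top ρ) ok n≤i i≤n with refl ← ℕₚ.≤-antisym n≤i i≤n
  with j , j∈ ← nonempty⇒rowOnes ρ (proj₁ (∧-true ok)) = j , rowCells⁺ n ρ j∈
valid⇒row {suc r} {n} fl (ρ ▹ M) ok {i} n≤i i≤ with n ℕₚ.≟ i
... | yes refl with j , j∈ ← nonempty⇒rowOnes ρ (proj₁ (∧-true ok)) = j , bottom⁺ ρ M j∈
... | no n≢i with j , p ← valid⇒row _ M (proj₂ (∧-true {nonempty ρ} ok)) (ℕₚ.≤∧≢⇒< n≤i n≢i)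
                            (subst (i ≤_) (sym (ℕₚ.+-suc r n)) i≤) = j , rest⁺ ρ M p

-- The flags stand for entries in rows below `M`, whence the alternative; it is empty once `fl` is
-- `[]`.
valid⇒col : ∀ fl (M : Tri r n) → valid fl M ≡ true → ∀ {j} → 1 ≤ j → j ≤ r + n →
  j ∈ ones fl ⊎ ∃ λ i → (i , j) ∈ triCells M
valid⇒col {n = n} fl (top (l , ρ)) ok 1≤j j≤
  with ones-∨⁻ fl ρ (allTrue⇒ones (fl ∨ᵥ ρ) (proj₂ (∧-true {nonempty (l , ρ)} ok)) 1≤j j≤)
... | inj₁ j∈ = inj₁ j∈
... | inj₂ j∈ = inj₂ (n , rowCells⁺ n (l , ρ) (rowOnes-ones l ρ j∈))
valid⇒col {suc r} {n} fl ((l , ρ) ▹ M) ok {j} 1≤j j≤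
  with valid⇒col _ M (proj₂ (∧-true {nonempty (l , ρ)} ok)) 1≤j (subst (j ≤_) (sym (ℕₚ.+-suc r n)) j≤)
... | inj₂ (i , p) = inj₂ (i , rest⁺ (l , ρ) M p)
... | inj₁ j∈ with ones-∨⁻ fl ρ j∈
...   | inj₁ q = inj₁ q
...   | inj₂ q = inj₂ (n , bottom⁺ (l , ρ) M (rowOnes-ones l ρ q))

valid⁺ : ∀ fl (M : Tri r n) → (∀ {i} → n ≤ i → i ≤ r + n → ∃ λ j → (i , j) ∈ triCells M) →
  (∀ {j} → 1 ≤ j → j ≤ r + n → j ∈ ones fl ⊎ ∃ λ i → (i , j) ∈ triCells M) → valid fl M ≡ true
valid⁺ {n = n} fl (top (l , ρ)) rows cols = cong₂ _∧_
  (let j , p = rows ℕₚ.≤-refl ℕₚ.≤-refl in rowOnes⇒nonempty (l , ρ) (proj₂ (rowCells⁻ n (l , ρ) p)))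
  (ones⇒allTrue (fl ∨ᵥ ρ) λ 1≤j j≤n → [ ones-∨ˡ fl ρ
    , (λ (i , p) → ones-∨ʳ fl ρ (rowOnes-ones⁻ l ρ 1≤j (proj₂ (rowCells⁻ n (l , ρ) p)))) ]′ (cols 1≤j j≤n))
valid⁺ {suc r} {n} fl ((l , ρ) ▹ M) rows cols = cong₂ _∧_
  (let j , p = rows ℕₚ.≤-refl (ℕₚ.m≤n+m n (suc r)) in rowOnes⇒nonempty (l , ρ) (bottom⁻ (l , ρ) M p))
  (valid⁺ (false ∷ (fl ∨ᵥ ρ)) M
    (λ {i} n<i i≤ → let j , p = rows (ℕₚ.<⇒≤ n<i) (subst (i ≤_) (ℕₚ.+-suc r n) i≤) in j , rest⁻ (l , ρ) M n<i p)
    (λ {j} 1≤j j≤ → column 1≤j (cols 1≤j (subst (j ≤_) (ℕₚ.+-suc r n) j≤))))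
  where
  column : ∀ {j} → 1 ≤ j → j ∈ ones fl ⊎ (∃ λ i → (i , j) ∈ triCells ((l , ρ) ▹ M)) →
    j ∈ ones (fl ∨ᵥ ρ) ⊎ ∃ λ i → (i , j) ∈ triCells M
  column 1≤j (inj₁ j∈) = inj₁ (ones-∨ˡ fl ρ j∈)
  column 1≤j (inj₂ (i , p)) with ∈ₚ.∈-++⁻ (rowCells n (l , ρ)) p
  ... | inj₁ q = inj₁ (ones-∨ʳ fl ρ (rowOnes-ones⁻ l ρ 1≤j (proj₂ (rowCells⁻ n (l , ρ) q))))
  ... | inj₂ q = inj₂ (i , q)

-- The matrix with prescribed entries

vecOf : (ℕ → Bool) → ∀ n → Vec Bool n
vecOf g zero    = []
vecOf g (suc n) = g (suc n) ∷ vecOf g n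

rowOf : (ℕ → Bool) → ∀ n → Row n
rowOf g n = g 0 , vecOf g n

triOf : (ℕ → ℕ → Bool) → ∀ r n → Tri r n
triOf f zero    n = top (rowOf (f n) n)
triOf f (suc r) n = (rowOf (f n) n) ▹ triOf f r (suc n)

vecOf⁻ : ∀ g n {j} → j ∈ ones (vecOf g n) → g j ≡ true
vecOf⁻ g (suc n) j∈ with g (suc n) in eq
vecOf⁻ g (suc n) (here refl) | true  = eq
vecOf⁻ g (suc n) (there j∈)  | true  = vecOf⁻ g n j∈
vecOf⁻ g (suc n) j∈          | false = vecOf⁻ g n j∈

vecOf⁺ : ∀ g n {j} → 1 ≤ j → j ≤ n → g j ≡ true → j ∈ ones (vecOf g n)
vecOf⁺ g zero    (s≤s _) () gj
vecOf⁺ g (suc n) {j} 1≤j j≤ gj with j ℕₚ.≟ suc n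
... | yes refl rewrite gj = here refl
... | no j≢ = ones-∷ (g (suc n)) (vecOf g n) (vecOf⁺ g n 1≤j (ℕₚ.≤-pred (ℕₚ.≤∧≢⇒< j≤ j≢)) gj)

rowOf⁻ : ∀ g n {j} → j ∈ rowOnes (rowOf g n) → g j ≡ true
rowOf⁻ g n {zero}  j∈ = rowOnes-0 (g 0) (vecOf g n) j∈
rowOf⁻ g n {suc j} j∈ = vecOf⁻ g n (rowOnes-ones⁻ (g 0) (vecOf g n) (s≤s z≤n) j∈)

rowOf⁺ : ∀ g n {j} → j ≤ n → g j ≡ true → j ∈ rowOnes (rowOf g n)
rowOf⁺ g n {zero}  _  gj rewrite gj = here refl
rowOf⁺ g n {suc j} j≤ gj = rowOnes-ones (g 0) (vecOf g n) (vecOf⁺ g n (s≤s z≤n) j≤ gj)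

triOf⁻ : ∀ f r n {i j} → (i , j) ∈ triCells (triOf f r n) → f i j ≡ true
triOf⁻ f zero    n p with refl , j∈ ← rowCells⁻ n (rowOf (f n) n) p = rowOf⁻ (f n) n j∈
triOf⁻ f (suc r) n p with ∈ₚ.∈-++⁻ (rowCells n (rowOf (f n) n)) p
... | inj₁ q with refl , j∈ ← rowCells⁻ n (rowOf (f n) n) q = rowOf⁻ (f n) n j∈
... | inj₂ q = triOf⁻ f r (suc n) q

triOf⁺ : ∀ f r n {i j} → Bounded r n i j → f i j ≡ true → (i , j) ∈ triCells (triOf f r n)
triOf⁺ f zero    n (bounded lo up be) fij with refl ← ℕₚ.≤-antisym lo up =
  rowCells⁺ n (rowOf (f n) n) (rowOf⁺ (f n) n be fij)
triOf⁺ f (suc r) n {i} (bounded lo up be) fij with n ℕₚ.≟ i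
... | yes refl = bottom⁺ (rowOf (f n) n) (triOf f r (suc n)) (rowOf⁺ (f n) n be fij)
... | no n≢i   = rest⁺ (rowOf (f n) n) (triOf f r (suc n)) (triOf⁺ f r (suc n)
  (bounded (ℕₚ.≤∧≢⇒< lo n≢i) (subst (i ≤_) (sym (ℕₚ.+-suc r n)) up) be) fij)

-- Statistics of a matrix from its cells

count-constant : ∀ {A : Set} (p : A → Bool) b xs → (∀ {x} → x ∈ xs → p x ≡ b) →
  length (filterᵇ p xs) ≡ (if b then length xs else 0)
count-constant p true  []       eq = refl
count-constant p false []       eq = refl
count-constant p b     (x ∷ xs) eq with count-constant p b xs (eq ∘ there)
... | IH rewrite eq (here refl) with b
...   | true  = cong suc IH
...   | false = IH

module _ (m : ℕ) (isTop isLast : Bool) where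

  classCount-row : ∀ i t → (i ≡ᵇ m) ≡ t → ∀ (ρ : Row n) →
    classCount m isTop isLast (rowCells i ρ) ≡ (if is isTop t then rowCount isLast ρ else 0)
  classCount-row i t eq (l , ρ) = go l
    where
    inner : classCount m isTop isLast (map (i ,_) (ones ρ)) ≡
      (if is isTop t ∧ is isLast false then countTrue ρ else 0)
    inner = trans (sym (length-filterᵇ-map (inClass m isTop isLast) (i ,_) _ (λ _ → refl) (ones ρ)))
      (trans (count-constant _ _ (ones ρ) (λ j∈ → cong₂ (λ p q → is isTop p ∧ is isLast q) eq (pos (ones-≥1 ρ j∈))))
        (cong (if is isTop t ∧ is isLast false then_else 0) (length-ones ρ)))
      where
      pos : ∀ {j} → 1 ≤ j → (j ≡ᵇ 0) ≡ false
      pos (s≤s _) = refl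

    go : ∀ l → classCount m isTop isLast (rowCells i (l , ρ)) ≡ (if is isTop t then rowCount isLast (l , ρ) else 0)
    go false = trans inner (cases (is isTop t) isLast)
      where
      cases : ∀ p q → (if p ∧ is q false then countTrue ρ else 0) ≡ (if p then rowCount q (false , ρ) else 0)
      cases true  true  = refl
      cases true  false = refl
      cases false q     = refl
    go true = trans head (trans (cong (λ k → bit (is isTop t ∧ is isLast true) + k) inner) (cases (is isTop t) isLast))
      where
      head : classCount m isTop isLast (rowCells i (true , ρ)) ≡
        bit (is isTop t ∧ is isLast true) + classCount m isTop isLast (map (i ,_) (ones ρ))
      head rewrite eq with is isTop t ∧ is isLast true
      ... | true  = refl
      ... | false = refl
      cases : ∀ p q → bit (p ∧ is q true) + (if p ∧ is q false then countTrue ρ else 0) ≡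
        (if p then rowCount q (true , ρ) else 0)
      cases true  true  = refl
      cases true  false = refl
      cases false q     = refl

  classCount-++ : ∀ xs ys → classCount m isTop isLast (xs ++ ys) ≡
    classCount m isTop isLast xs + classCount m isTop isLast ys
  classCount-++ xs ys = trans (cong length (Listₚ.filter-++ _ xs ys)) (Listₚ.length-++ (filterᵇ (inClass m isTop isLast) xs))

  -- The equation `m ≡ r + n` places the top row of `M` in row `m` and survives the removal of the
  -- bottom row.
  classCount-tri : ∀ (M : Tri r n) → m ≡ r + n → classCount m isTop isLast (triCells M) ≡ cellCount isTop isLast M
  classCount-tri {n = n} (top ρ) refl = trans (classCount-row n true (≡⇒≡ᵇ-true {n} refl) ρ) (cases isTop)
    where
    cases : ∀ τ → (if is τ true then rowCount isLast ρ else 0) ≡ (if τ then rowCount isLast ρ else 0)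
    cases true  = refl
    cases false = refl
  classCount-tri {suc r} {n} (ρ ▹ M) eq = trans (classCount-++ (rowCells n ρ) (triCells M)) (cong₂ _+_
    (trans (classCount-row n false (≢⇒≡ᵇ-false n≢m) ρ) (cases isTop))
    (classCount-tri M (trans eq (sym (ℕₚ.+-suc r n)))))
    where
    n≢m : n ≢ m
    n≢m n≡m = ℕₚ.1+n≰n (ℕₚ.≤-trans (s≤s (ℕₚ.m≤n+m n r)) (ℕₚ.≤-reflexive (trans (sym eq) (sym n≡m))))
    cases : ∀ τ → (if is τ false then rowCount isLast ρ else 0) ≡ (if τ then 0 else rowCount isLast ρ)
    cases true  = refl
    cases false = refl

-- Enumeration of the matrices without repetition

bools-complete : ∀ b → b ∈ bools
bools-complete true  = here refl
bools-complete false = there (here refl)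

bools-unique : Unique bools
bools-unique = ((λ ()) All.∷ All.[]) ∷ All.[] ∷ []

allVecs-complete : ∀ (v : Vec Bool n) → v ∈ allVecs n
allVecs-complete []      = here refl
allVecs-complete (b ∷ v) = ∈ₚ.∈-cartesianProductWith⁺ _∷_ (bools-complete b) (allVecs-complete v)

allVecs-unique : ∀ n → Unique (allVecs n)
allVecs-unique zero    = All.[] ∷ []
allVecs-unique (suc n) = Uniqueₚ.cartesianProductWith⁺ _∷_ (λ { refl → refl , refl }) bools-unique (allVecs-unique n)

allRows-complete : ∀ (ρ : Row n) → ρ ∈ allRows n
allRows-complete (l , ρ) = ∈ₚ.∈-cartesianProduct⁺ (bools-complete l) (allVecs-complete ρ)

allRows-unique : ∀ n → Unique (allRows n)
allRows-unique n = Uniqueₚ.cartesianProduct⁺ bools-unique (allVecs-unique n)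

allTris-complete : ∀ (M : Tri r n) → M ∈ allTris r n
allTris-complete (top ρ) = ∈ₚ.∈-map⁺ top (allRows-complete ρ)
allTris-complete (ρ ▹ M) = ∈ₚ.∈-cartesianProductWith⁺ _▹_ (allRows-complete ρ) (allTris-complete M)

allTris-unique : ∀ r n → Unique (allTris r n)
allTris-unique zero    n = Uniqueₚ.map⁺ (λ { refl → refl }) (allRows-unique n)
allTris-unique (suc r) n =
  Uniqueₚ.cartesianProductWith⁺ _▹_ (λ { refl → refl , refl }) (allRows-unique n) (allTris-unique r (suc n))

-- From matrices to posets

triPoset : (M : Tri r n) → Poset (length (triCells M))
triPoset M = record
  { _≺_    = λ x y → row y <ᵇ col x
  ; irrefl = λ x → ≤⇒<ᵇ-false (col≤row x)
  -- Triangularity at the middle element links the two relations: `row z < col y ≤ row y < col x`.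
  ; trans  = λ x y z x≺y y≺z → <⇒<ᵇ-true {row z} {col x}
      (ℕₚ.<-trans (<ᵇ-true⇒< {row z} {col y} y≺z) (ℕₚ.≤-<-trans (col≤row y) (<ᵇ-true⇒< {row y} {col x} x≺y)))
  }
  where
  row col : Fin (length (triCells M)) → ℕ
  row x = proj₁ (lookup (triCells M) x)
  col x = proj₂ (lookup (triCells M) x)
  col≤row : ∀ x → col x ≤ row x
  col≤row x = below (triCells-bounded M (∈ₚ.∈-lookup x))

triRep : ∀ {m} (M : Tri m 0) → valid [] M ≡ true → Rep (triPoset M) m
triRep {m} M ok = record
  { row      = proj₁ ∘ lookup cs
  ; col      = proj₂ ∘ lookup cs
  ; col≤row  = λ x → below (bound x)
  ; row≤     = λ x → subst (proj₁ (lookup cs x) ≤_) (ℕₚ.+-identityʳ m) (upper (bound x))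
  ; rel      = λ _ _ → refl
  ; row-onto = λ i i≤m → let j , p = row-cell i≤m in index p , sym (cong proj₁ (Anyₚ.lookup-index p))
  ; col-onto = λ j j≤m → let i , p = col-cell j j≤m in index p , sym (cong proj₂ (Anyₚ.lookup-index p))
  ; cell-inj = λ rx cx → lookup-injective (triCells-unique M) (cong₂ _,_ rx cx)
  }
  where
  cs = triCells M
  bound : ∀ x → Bounded m 0 (proj₁ (lookup cs x)) (proj₂ (lookup cs x))
  bound x = triCells-bounded M (∈ₚ.∈-lookup x)

  row-cell : ∀ {i} → i ≤ m → ∃ λ j → (i , j) ∈ cs
  row-cell {i} i≤m = valid⇒row [] M ok z≤n (subst (i ≤_) (sym (ℕₚ.+-identityʳ m)) i≤m)

  col-cell : ∀ j → j ≤ m → ∃ λ i → (i , j) ∈ cs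
  -- The last column has no flag, but the nonempty bottom row has its only possible entry there.
  col-cell zero    _   with j , p ← row-cell z≤n with z≤n ← below (triCells-bounded M p) = 0 , p
  col-cell (suc j) j≤m with valid⇒col [] M ok (s≤s z≤n) (subst (suc j ≤_) (sym (ℕₚ.+-identityʳ m)) j≤m)
  ... | inj₂ p = p

triRep-cells : ∀ {m} (M : Tri m 0) ok → Rep.cells (triRep M ok) ≡ triCells M
triRep-cells M ok = trans (Listₚ.map-tabulate id (lookup (triCells M))) (Listₚ.tabulate-lookup (triCells M))

Counted : ℕ → ℕ → ℕ → ℕ → ∀ {m} → Tri m 0 → Set
Counted b c d e M = valid [] M ≡ true × cellCount false true M ≡ b × cellCount false false M ≡ c ×
  cellCount true true M ≡ d × cellCount true false M ≡ e

countedᵇ : ℕ → ℕ → ℕ → ℕ → ∀ {m} → Tri m 0 → Bool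
countedᵇ b c d e M = valid [] M ∧ hasStats b c d e M

countedᵇ⁻ : ∀ {b c d e m} (M : Tri m 0) → countedᵇ b c d e M ≡ true → Counted b c d e M
countedᵇ⁻ M p =
  let ok , p₁ = ∧-true p ; q₁ , p₂ = ∧-true p₁ ; q₂ , p₃ = ∧-true p₂ ; q₃ , q₄ = ∧-true p₃
  in ok , ≡ᵇ-true⇒≡ q₁ , ≡ᵇ-true⇒≡ q₂ , ≡ᵇ-true⇒≡ q₃ , ≡ᵇ-true⇒≡ q₄

countedᵇ⁺ : ∀ {b c d e m} (M : Tri m 0) → Counted b c d e M → countedᵇ b c d e M ≡ true
countedᵇ⁺ M (ok , q₁ , q₂ , q₃ , q₄) = cong₂ _∧_ ok (cong₂ _∧_ (≡⇒≡ᵇ-true q₁)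
  (cong₂ _∧_ (≡⇒≡ᵇ-true q₂) (cong₂ _∧_ (≡⇒≡ᵇ-true q₃) (≡⇒≡ᵇ-true q₄))))

toPoset : ∀ {m} → Tri m 0 → FinPoset
toPoset M = length (triCells M) , triPoset M

module _ {b c d e m : ℕ} where

  toPoset-counted : ∀ (M : Tri m 0) → Counted b c d e M → CountedAt (suc m) b c d e (toPoset M)
  toPoset-counted M (ok , q₁ , q₂ , q₃ , q₄) =
    nonzero (proj₁ (R.row-onto 0 z≤n)) , R.intervalOrder , R.isPrimitive , R.mag≡
    , trans R.max#≡ (trans (count false true) q₁) , trans R.int#≡ (trans (count false false) q₂)
    , trans R.iso#≡ (trans (count true true) q₃) , trans R.min#≡ (trans (count true false) q₄)
    where
    module R = Rep (triRep M ok)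
    nonzero : ∀ {k} → Fin k → 0 < k
    nonzero {suc k} _ = s≤s z≤n
    count : ∀ τ κ → classCount m τ κ R.cells ≡ cellCount τ κ M
    count τ κ = trans (cong (classCount m τ κ) (triRep-cells M ok)) (classCount-tri m τ κ M (sym (ℕₚ.+-identityʳ m)))

-- By `cell-iso` an isomorphism sends each element to one with the same cell, so both matrices have
-- the same nonzero entries.
toPoset-injective : ∀ {m} {M N : Tri m 0} → valid [] M ≡ true → valid [] N ≡ true → toPoset M ≅ toPoset N → M ≡ N
toPoset-injective {m} {M} {N} okM okN iso = triCells-injective M N sub sub′
  where
  ρ = triRep M okM
  σ = triRep N okN
  to = Inverse.to (proj₁ iso)
  from = Inverse.from (proj₁ iso)

  sub : ∀ {z} → z ∈ triCells M → z ∈ triCells N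
  sub p = subst (_∈ triCells N) (trans (cell-iso ρ σ iso (index p)) (sym (Anyₚ.lookup-index p)))
    (∈ₚ.∈-lookup (to (index p)))

  sub′ : ∀ {z} → z ∈ triCells N → z ∈ triCells M
  sub′ p = subst (_∈ triCells M)
    (trans (sym (cell-iso ρ σ iso (from (index p))))
      (trans (cong (lookup (triCells N)) (Inverse.strictlyInverseˡ (proj₁ iso) (index p))) (sym (Anyₚ.lookup-index p))))
    (∈ₚ.∈-lookup (from (index p)))

-- From posets to matrices

module FromRep {k m} {P : Poset k} (ρ : Rep P m) where
  open Rep ρ

  private
    occupied? : ∀ i j → Dec (∃ λ x → row x ≡ i × col x ≡ j)
    occupied? i j = Finₚ.any? λ x → (row x ℕₚ.≟ i) ×-dec (col x ℕₚ.≟ j)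

    occupied⁻ : ∀ {i j} → does (occupied? i j) ≡ true → ∃ λ x → row x ≡ i × col x ≡ j
    occupied⁻ {i} {j} eq with occupied? i j
    ... | yes p = p

  matrix : Tri m 0
  matrix = triOf (λ i j → does (occupied? i j)) m 0

  cell∈ : ∀ x → cell x ∈ triCells matrix
  cell∈ x = triOf⁺ _ m 0 (bounded z≤n (subst (row x ≤_) (sym (ℕₚ.+-identityʳ m)) (row≤ x)) (col≤row x))
    (dec-true (occupied? (row x) (col x)) (x , refl , refl))

  cell⁻ : ∀ {z} → z ∈ triCells matrix → ∃ λ x → cell x ≡ z
  cell⁻ p with x , refl , refl ← occupied⁻ (triOf⁻ _ m 0 p) = x , refl

  matrix-valid : valid [] matrix ≡ true
  matrix-valid = valid⁺ [] matrix
    (λ {i} _ i≤ → let x , rx = row-onto i (subst (i ≤_) (ℕₚ.+-identityʳ m) i≤) in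
      col x , subst (λ i → (i , col x) ∈ triCells matrix) rx (cell∈ x))
    (λ {j} _ j≤ → let x , cx = col-onto j (subst (j ≤_) (ℕₚ.+-identityʳ m) j≤) in
      inj₂ (row x , subst (λ j → (row x , j) ∈ triCells matrix) cx (cell∈ x)))

  -- One list follows the numbering of the elements, the other runs row by row; the statistics
  -- depend only on the multiset.
  cells↭ : cells ↭ triCells matrix
  cells↭ = unique⇒↭
    (Uniqueₚ.map⁺ (λ eq → cell-inj (cong proj₁ eq) (cong proj₂ eq)) (Uniqueₚ.allFin⁺ k))
    (triCells-unique matrix)
    (λ z∈ → let x , _ , eq = ∈ₚ.∈-map⁻ cell z∈ in subst (_∈ triCells matrix) (sym eq) (cell∈ x))
    (λ z∈ → let x , eq = cell⁻ z∈ in subst (_∈ cells) eq (∈ₚ.∈-map⁺ cell (∈ₚ.∈-allFin x)))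

  cellCount-matrix : ∀ τ κ → cellCount τ κ matrix ≡ classCount m τ κ cells
  cellCount-matrix τ κ = trans (sym (classCount-tri m τ κ matrix (sym (ℕₚ.+-identityʳ m))))
    (sym (↭ₚ.↭-length (↭ₚ.filter-↭ _ cells↭)))

  matrix-iso : (k , P) ≅ toPoset matrix
  matrix-iso = mk↔ₛ′ to from to-from from-to , preserves
    where
    cs = triCells matrix
    to : Fin k → Fin (length cs)
    to x = index (cell∈ x)
    from : Fin (length cs) → Fin k
    from y = proj₁ (cell⁻ (∈ₚ.∈-lookup {xs = cs} y))
    lookup-to : ∀ x → lookup cs (to x) ≡ cell x
    lookup-to x = sym (Anyₚ.lookup-index (cell∈ x))
    cell-from : ∀ y → cell (from y) ≡ lookup cs y
    cell-from y = proj₂ (cell⁻ (∈ₚ.∈-lookup {xs = cs} y))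
    to-from : ∀ y → to (from y) ≡ y
    to-from y = lookup-injective (triCells-unique matrix) (trans (lookup-to (from y)) (cell-from y))
    from-to : ∀ x → from (to x) ≡ x
    from-to x = cell-inj (cong proj₁ eq) (cong proj₂ eq)
      where eq = trans (cell-from (to x)) (lookup-to x)
    preserves : ∀ x y → Poset._≺_ P x y ≡ Poset._≺_ (triPoset matrix) (to x) (to y)
    preserves x y = trans (rel x y) (sym (cong₂ (λ z z′ → proj₁ z′ <ᵇ proj₂ z) (lookup-to x) (lookup-to y)))

  matrix-counted : ∀ {b c d e} → CountedAt (suc m) b c d e (k , P) → Counted b c d e matrix
  matrix-counted (_ , _ , _ , _ , q₁ , q₂ , q₃ , q₄) = matrix-valid
    , trans (cellCount-matrix false true) (trans (sym max#≡) q₁)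
    , trans (cellCount-matrix false false) (trans (sym int#≡) q₂)
    , trans (cellCount-matrix true true) (trans (sym iso#≡) q₃)
    , trans (cellCount-matrix true false) (trans (sym min#≡) q₄)

-- Representatives of the isomorphism classes

allPairs-map : ∀ {A B : Set} {V : A → Set} {R : B → B → Set} (f : A → B) →
  (∀ {x y} → V x → V y → x ≢ y → R (f x) (f y)) → ∀ {xs} → All V xs → Unique xs → AllPairs R (map f xs)
allPairs-map f h All.[]       []       = []
allPairs-map f h (v All.∷ vs) (p ∷ ps) =
  Allₚ.map⁺ (All.zipWith (λ (vy , x≢y) → h v vy x≢y) (vs , p)) ∷ allPairs-map f h vs ps

theorem1 : ∀ (a b c d e : ℕ) →
    ∃ λ (L : List FinPoset) →
    IsoClassReps (CountedAt a b c d e) L × + length L ≡ rhs a b c d e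
theorem1 zero b c d e = [] , (All.[] , [] , none) , sym (rhs-zero b c d e)
  where
  none : ∀ P → CountedAt 0 b c d e P → Any (P ≅_) []
  -- With an element present, the deduplicated list of down-sets has a head, so its length is not 0.
  none (suc k , P) (_ , _ , _ , () , _)
theorem1 (suc m) b c d e = map toPoset Ms , (all-counted , distinct , complete) ,
  trans (cong +_ (Listₚ.length-map toPoset Ms)) (length-counted-rhs m b c d e)
  where
  Ms : List (Tri m 0)
  Ms = filterᵇ (countedᵇ b c d e) (allTris m 0)
  Ms-counted : All (Counted b c d e) Ms
  Ms-counted = All.map (λ {M} p → countedᵇ⁻ M (Equivalence.to 𝔹ₚ.T-≡ p)) (Allₚ.all-filter _ (allTris m 0))
  all-counted : All (CountedAt (suc m) b c d e) (map toPoset Ms)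
  all-counted = Allₚ.map⁺ (All.map (λ {M} → toPoset-counted M) Ms-counted)
  distinct : AllPairs (λ P R → ¬ (P ≅ R)) (map toPoset Ms)
  distinct = allPairs-map toPoset (λ p q M≢N iso → M≢N (toPoset-injective (proj₁ p) (proj₁ q) iso))
    Ms-counted (Uniqueₚ.filter⁺ _ (allTris-unique m 0))
  complete : ∀ P → CountedAt (suc m) b c d e P → Any (P ≅_) (map toPoset Ms)
  complete (k , P) counted@(_ , io , prim , mag≡ , _) =
    lose (∈ₚ.∈-map⁺ toPoset (∈ₚ.∈-filter⁺ _ (allTris-complete F.matrix)
      (Equivalence.from 𝔹ₚ.T-≡ (countedᵇ⁺ F.matrix (F.matrix-counted counted))))) F.matrix-iso
    where module F = FromRep (primitive⇒Rep P io prim mag≡)
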